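{- Let $c\ge2$, let $\Gamma$ be a $c$-uniform unoriented hypergraph with $E\neq\varnothing$ and no isolated vertices, with smallest normalized Laplacian eigenvalue $\lambda_1$, and let $q\in[0,c-1]$ be real. Then \[ \chi^{q\text{ -t}}(\Gamma)\;\ge\;\frac{c-\lambda_1}{q+1-\lambda_1}. \] Moreover, the bound is sharp: whenever $q$ is an integer with $(q+1)\mid c$, there exists a $c$-uniform unoriented hypergraph attaining equality.
   Context: A hypergraph has finite vertex set $V$ and edge set $E\subseteq\mathcal P(V)$; it is $c$-uniform if $|e|=c$ for all $e$, and unoriented means all incidences have orientation $+1$. $\deg v=|\{e\in E: v\in e\}|\ge1$, $D=\mathrm{diag}(\deg v)$, adjacency $A_{v,v}=0$ and $A_{v,w}=-|\{e\in E: v,w\in e\}|$ for $v\ne w$, normalized Laplacian $L=\mathrm{Id}-D^{ -1}A$ with eigenvalues $\lambda_1\le\dots\le\lambda_N$. For $q\in[0,c-1]$, a $k$-coloring $V\to\{1,\dots,k\}$ with color classes $V_1,\dots,V_k$ is $q$-tailored if for all $i$ and all $v\in V_i$, $\sum_{w\in V_i}|A_{v,w}|\le q\deg v$; $\chi^{q\text{ -t}}(\Gamma)$ is the least $k$ admitting a $q$-tailored $k$-coloring. -}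

module Defs where

open import Data.Nat as ℕ using (ℕ)
import Data.Nat.Properties as ℕ
open import Data.Integer as ℤ using (ℤ)
open import Data.Rational as ℚ using (ℚ; 0ℚ; 1ℚ)
import Data.Rational.Properties as ℚ
open import Data.Rational.Solver using (module +-*-Solver)
open import Data.Fin using (Fin)
import Data.Fin as Fin
open import Data.Fin.Subset using (Subset; ∣_∣)
open import Data.Fin.Subset.Properties using (_∈?_)
open import Data.List using (List; length; filter; map; allFin)
open import Data.Nat.ListAction using (sum)
open import Data.List.Relation.Unary.All using (All)
open import Data.List.Relation.Unary.Unique.Propositional using (Unique)
open import Data.Vec.Functional using (foldr)
open import Data.Product using (∃; _×_; _,_)
open import Data.Bool using (if_then_else_)
open import Relation.Nullary using (¬_; yes; no; does; contradiction)
open import Relation.Nullary.Decidable using (_×-dec_)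
open import Relation.Binary.PropositionalEquality using (_≡_; refl; sym; trans; cong; cong₂; subst)

-- Real numbers: Cauchy sequences of rationals carrying a modulus of
-- convergence, compared by the setoid equality _≈ℝ_.

IsCauchy : (ℕ → ℚ) → Set
IsCauchy s = ∀ ε → 0ℚ ℚ.< ε →
  ∃ λ N → ∀ m n → N ℕ.≤ m → N ℕ.≤ n → ℚ.∣ s m ℚ.- s n ∣ ℚ.≤ ε

record ℝ : Set where
  constructor mkℝ
  field
    seq    : ℕ → ℚ
    cauchy : IsCauchy seq

open ℝ public

Eventually : (ℕ → Set) → Set
Eventually P = ∃ λ N → ∀ n → N ℕ.≤ n → P n

infix 4 _≈ℝ_ _≤ℝ_ _<ℝ_

_≈ℝ_ : ℝ → ℝ → Set
x ≈ℝ y = ∀ ε → 0ℚ ℚ.< ε → Eventually λ n → ℚ.∣ seq x n ℚ.- seq y n ∣ ℚ.≤ ε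

_≤ℝ_ : ℝ → ℝ → Set
x ≤ℝ y = ∀ ε → 0ℚ ℚ.< ε → Eventually λ n → seq x n ℚ.≤ seq y n ℚ.+ ε

_<ℝ_ : ℝ → ℝ → Set
x <ℝ y = ∃ λ ε → 0ℚ ℚ.< ε × Eventually λ n → seq x n ℚ.+ ε ℚ.≤ seq y n

private
  open ℚ.≤-Reasoning
  open +-*-Solver using (solve; _:+_; _:*_; _:-_; :-_; _:=_)

  regroup₁ : ∀ a b → a ≡ b ℚ.+ (a ℚ.- b)
  regroup₁ = solve 2 (λ a b → a := b :+ (a :- b)) refl

  regroup₂ : ∀ a b c d → (a ℚ.+ b) ℚ.- (c ℚ.+ d) ≡ (a ℚ.- c) ℚ.+ (b ℚ.- d)
  regroup₂ = solve 4 (λ a b c d → (a :+ b) :- (c :+ d) := (a :- c) :+ (b :- d)) refl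

  regroup₃ : ∀ a b → ℚ.- a ℚ.- ℚ.- b ≡ b ℚ.- a
  regroup₃ = solve 2 (λ a b → :- a :- :- b := b :- a) refl

  regroup₄ : ∀ a b c d → a ℚ.* b ℚ.- c ℚ.* d ≡ a ℚ.* (b ℚ.- d) ℚ.+ d ℚ.* (a ℚ.- c)
  regroup₄ = solve 4 (λ a b c d → a :* b :- c :* d := a :* (b :- d) :+ d :* (a :- c)) refl

  regroup₅ : ∀ a b i j → (a ℚ.* b) ℚ.* (i ℚ.- j) ≡ (a ℚ.* i) ℚ.* b ℚ.- (b ℚ.* j) ℚ.* a
  regroup₅ = solve 4 (λ a b i j → (a :* b) :* (i :- j) := (a :* i) :* b :- (b :* j) :* a) refl

  0<½ : 0ℚ ℚ.< ℚ.½
  0<½ = ℚ.positive⁻¹ ℚ.½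

  0<1 : 0ℚ ℚ.< 1ℚ
  0<1 = ℚ.positive⁻¹ 1ℚ

  0<* : ∀ {p q} → 0ℚ ℚ.< p → 0ℚ ℚ.< q → 0ℚ ℚ.< p ℚ.* q
  0<* {p} {q} 0<p 0<q =
    ℚ.positive⁻¹ _ {{ℚ.pos*pos⇒pos p {{ℚ.positive 0<p}} q {{ℚ.positive 0<q}}}}

  halves : ∀ ε → ℚ.½ ℚ.* ε ℚ.+ ℚ.½ ℚ.* ε ≡ ε
  halves ε = begin-equality
    ℚ.½ ℚ.* ε ℚ.+ ℚ.½ ℚ.* ε ≡⟨ ℚ.*-distribʳ-+ ε ℚ.½ ℚ.½ ⟨
    1ℚ ℚ.* ε                ≡⟨ ℚ.*-identityˡ ε ⟩
    ε                       ∎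

  *-mono : ∀ {p q r s} → 0ℚ ℚ.≤ r → 0ℚ ℚ.≤ q → p ℚ.≤ q → r ℚ.≤ s →
           p ℚ.* r ℚ.≤ q ℚ.* s
  *-mono {p} {q} {r} {s} 0≤r 0≤q p≤q r≤s = ℚ.≤-trans
    (ℚ.*-monoʳ-≤-nonNeg r {{ℚ.nonNegative 0≤r}} p≤q)
    (ℚ.*-monoˡ-≤-nonNeg q {{ℚ.nonNegative 0≤q}} r≤s)

  bound : (x : ℝ) → ∃ λ B → 0ℚ ℚ.< B × Eventually λ n → ℚ.∣ seq x n ∣ ℚ.≤ B
  bound x with cauchy x 1ℚ 0<1
  ... | N , h = ℚ.∣ seq x N ∣ ℚ.+ 1ℚ
              , ℚ.+-mono-≤-< (ℚ.0≤∣p∣ (seq x N)) 0<1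
              , N , λ n N≤n → begin
    ℚ.∣ seq x n ∣
      ≡⟨ cong ℚ.∣_∣ (regroup₁ (seq x n) (seq x N)) ⟩
    ℚ.∣ seq x N ℚ.+ (seq x n ℚ.- seq x N) ∣
      ≤⟨ ℚ.∣p+q∣≤∣p∣+∣q∣ (seq x N) _ ⟩
    ℚ.∣ seq x N ∣ ℚ.+ ℚ.∣ seq x n ℚ.- seq x N ∣
      ≤⟨ ℚ.+-monoʳ-≤ ℚ.∣ seq x N ∣ (h n N N≤n ℕ.≤-refl) ⟩
    ℚ.∣ seq x N ∣ ℚ.+ 1ℚ ∎

  +-cauchy : (x y : ℝ) → IsCauchy (λ n → seq x n ℚ.+ seq y n)
  +-cauchy x y ε 0<ε with cauchy x (ℚ.½ ℚ.* ε) (0<* {ℚ.½} {ε} 0<½ 0<ε) | cauchy y (ℚ.½ ℚ.* ε) (0<* {ℚ.½} {ε} 0<½ 0<ε)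
  ... | M , f | N , g = M ℕ.⊔ N , λ m n hm hn → begin
    ℚ.∣ (seq x m ℚ.+ seq y m) ℚ.- (seq x n ℚ.+ seq y n) ∣
      ≡⟨ cong ℚ.∣_∣ (regroup₂ (seq x m) (seq y m) (seq x n) (seq y n)) ⟩
    ℚ.∣ (seq x m ℚ.- seq x n) ℚ.+ (seq y m ℚ.- seq y n) ∣
      ≤⟨ ℚ.∣p+q∣≤∣p∣+∣q∣ (seq x m ℚ.- seq x n) _ ⟩
    ℚ.∣ seq x m ℚ.- seq x n ∣ ℚ.+ ℚ.∣ seq y m ℚ.- seq y n ∣
      ≤⟨ ℚ.+-mono-≤ (f m n (ℕ.m⊔n≤o⇒m≤o M N hm) (ℕ.m⊔n≤o⇒m≤o M N hn))
                    (g m n (ℕ.m⊔n≤o⇒n≤o M N hm) (ℕ.m⊔n≤o⇒n≤o M N hn)) ⟩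
    ℚ.½ ℚ.* ε ℚ.+ ℚ.½ ℚ.* ε
      ≡⟨ halves ε ⟩
    ε ∎

  neg-cauchy : (x : ℝ) → IsCauchy (λ n → ℚ.- seq x n)
  neg-cauchy x ε 0<ε with cauchy x ε 0<ε
  ... | N , f = N , λ m n hm hn → begin
    ℚ.∣ ℚ.- seq x m ℚ.- ℚ.- seq x n ∣
      ≡⟨ cong ℚ.∣_∣ (regroup₃ (seq x m) (seq x n)) ⟩
    ℚ.∣ seq x n ℚ.- seq x m ∣
      ≤⟨ f n m hn hm ⟩
    ε ∎

  scaled : ∀ {C} → 0ℚ ℚ.< C → ∀ {ε} → 0ℚ ℚ.< ε → ∃ λ δ → 0ℚ ℚ.< δ × C ℚ.* δ ≡ ε
  scaled {C} 0<C {ε} 0<ε =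
    1/C ℚ.* ε , 0<* {1/C} 0<1/C 0<ε
              , trans (sym (ℚ.*-assoc C 1/C ε))
                  (trans (cong (ℚ._* ε) (ℚ.*-inverseʳ C {{C≢0}})) (ℚ.*-identityˡ ε))
    where
    C≢0 : ℚ.NonZero C
    C≢0 = ℚ.pos⇒nonZero C {{ℚ.positive 0<C}}
    1/C : ℚ
    1/C = ℚ.1/_ C {{C≢0}}
    0<1/C : 0ℚ ℚ.< 1/C
    0<1/C = ℚ.positive⁻¹ 1/C {{ℚ.1/pos⇒pos C {{ℚ.positive 0<C}}}}

  *-close : ∀ a b c d {B C δ} → 0ℚ ℚ.≤ B → 0ℚ ℚ.≤ C → ℚ.∣ a ∣ ℚ.≤ B → ℚ.∣ d ∣ ℚ.≤ C →
            ℚ.∣ a ℚ.- c ∣ ℚ.≤ δ → ℚ.∣ b ℚ.- d ∣ ℚ.≤ δ →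
            ℚ.∣ a ℚ.* b ℚ.- c ℚ.* d ∣ ℚ.≤ (B ℚ.+ C) ℚ.* δ
  *-close a b c d {B} {C} {δ} 0≤B 0≤C a≤B d≤C a-c≤δ b-d≤δ = begin
    ℚ.∣ a ℚ.* b ℚ.- c ℚ.* d ∣
      ≡⟨ cong ℚ.∣_∣ (regroup₄ a b c d) ⟩
    ℚ.∣ a ℚ.* (b ℚ.- d) ℚ.+ d ℚ.* (a ℚ.- c) ∣
      ≤⟨ ℚ.∣p+q∣≤∣p∣+∣q∣ (a ℚ.* (b ℚ.- d)) (d ℚ.* (a ℚ.- c)) ⟩
    ℚ.∣ a ℚ.* (b ℚ.- d) ∣ ℚ.+ ℚ.∣ d ℚ.* (a ℚ.- c) ∣
      ≡⟨ cong₂ ℚ._+_ (ℚ.∣p*q∣≡∣p∣*∣q∣ a (b ℚ.- d)) (ℚ.∣p*q∣≡∣p∣*∣q∣ d (a ℚ.- c)) ⟩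
    ℚ.∣ a ∣ ℚ.* ℚ.∣ b ℚ.- d ∣ ℚ.+ ℚ.∣ d ∣ ℚ.* ℚ.∣ a ℚ.- c ∣
      ≤⟨ ℚ.+-mono-≤ {ℚ.∣ a ∣ ℚ.* ℚ.∣ b ℚ.- d ∣} {B ℚ.* δ} {ℚ.∣ d ∣ ℚ.* ℚ.∣ a ℚ.- c ∣} {C ℚ.* δ}
           (*-mono {ℚ.∣ a ∣} {B} {ℚ.∣ b ℚ.- d ∣} {δ} (ℚ.0≤∣p∣ (b ℚ.- d)) 0≤B a≤B b-d≤δ)
           (*-mono {ℚ.∣ d ∣} {C} {ℚ.∣ a ℚ.- c ∣} {δ} (ℚ.0≤∣p∣ (a ℚ.- c)) 0≤C d≤C a-c≤δ) ⟩
    B ℚ.* δ ℚ.+ C ℚ.* δ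
      ≡⟨ ℚ.*-distribʳ-+ δ B C ⟨
    (B ℚ.+ C) ℚ.* δ ∎

  *-cauchy : (x y : ℝ) → IsCauchy (λ n → seq x n ℚ.* seq y n)
  *-cauchy x y ε 0<ε =
    let
      B , 0<B , K , f = bound x
      C , 0<C , L , g = bound y
      δ , 0<δ , eq = scaled {B ℚ.+ C} (ℚ.+-mono-< {0ℚ} {B} {0ℚ} {C} 0<B 0<C) 0<ε
      M , u = cauchy x δ 0<δ
      N , v = cauchy y δ 0<δ
      KL≤ : ∀ {i} → (K ℕ.⊔ L) ℕ.⊔ (M ℕ.⊔ N) ℕ.≤ i → K ℕ.⊔ L ℕ.≤ i
      KL≤ = ℕ.m⊔n≤o⇒m≤o (K ℕ.⊔ L) (M ℕ.⊔ N)
      MN≤ : ∀ {i} → (K ℕ.⊔ L) ℕ.⊔ (M ℕ.⊔ N) ℕ.≤ i → M ℕ.⊔ N ℕ.≤ i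
      MN≤ = ℕ.m⊔n≤o⇒n≤o (K ℕ.⊔ L) (M ℕ.⊔ N)
    in (K ℕ.⊔ L) ℕ.⊔ (M ℕ.⊔ N) , λ m n hm hn →
      subst (ℚ.∣ seq x m ℚ.* seq y m ℚ.- seq x n ℚ.* seq y n ∣ ℚ.≤_) eq
        (*-close (seq x m) (seq y m) (seq x n) (seq y n) {B} {C} {δ} (ℚ.<⇒≤ 0<B) (ℚ.<⇒≤ 0<C)
          (f m (ℕ.m⊔n≤o⇒m≤o K L (KL≤ hm)))
          (g n (ℕ.m⊔n≤o⇒n≤o K L (KL≤ hn)))
          (u m n (ℕ.m⊔n≤o⇒m≤o M N (MN≤ hm)) (ℕ.m⊔n≤o⇒m≤o M N (MN≤ hn)))
          (v m n (ℕ.m⊔n≤o⇒n≤o M N (MN≤ hm)) (ℕ.m⊔n≤o⇒n≤o M N (MN≤ hn))))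

fromℚ : ℚ → ℝ
fromℚ p = mkℝ (λ _ → p) λ ε 0<ε → 0 , λ _ _ _ _ →
  subst (ℚ._≤ ε) (cong ℚ.∣_∣ (sym (ℚ.+-inverseʳ p))) (ℚ.<⇒≤ 0<ε)

fromℕ : ℕ → ℝ
fromℕ n = fromℚ (ℤ.+ n ℚ./ 1)

0ℝ 1ℝ : ℝ
0ℝ = fromℚ 0ℚ
1ℝ = fromℚ 1ℚ

infixl 6 _+ℝ_ _-ℝ_
infixl 7 _*ℝ_
infix  8 -ℝ_

_+ℝ_ : ℝ → ℝ → ℝ
x +ℝ y = mkℝ (λ n → seq x n ℚ.+ seq y n) (+-cauchy x y)

-ℝ_ : ℝ → ℝ
-ℝ x = mkℝ (λ n → ℚ.- seq x n) (neg-cauchy x)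

_-ℝ_ : ℝ → ℝ → ℝ
x -ℝ y = x +ℝ -ℝ y

_*ℝ_ : ℝ → ℝ → ℝ
x *ℝ y = mkℝ (λ n → seq x n ℚ.* seq y n) (*-cauchy x y)

-- The value at 0 is irrelevant: it is only met at finitely many indices of
-- a positive real.
1/₀_ : ℚ → ℚ
1/₀ p with p ℚ.≟ 0ℚ
... | yes _   = 0ℚ
... | no  p≢0 = ℚ.1/_ p {{ℚ.≢-nonZero p≢0}}

private
  1/₀-inverse : ∀ {p} → 0ℚ ℚ.< p → p ℚ.* 1/₀ p ≡ 1ℚ
  1/₀-inverse {p} 0<p with p ℚ.≟ 0ℚ
  ... | yes p≡0 = contradiction (sym p≡0) (ℚ.<⇒≢ 0<p)
  ... | no  p≢0 = ℚ.*-inverseʳ p {{ℚ.≢-nonZero p≢0}}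

  -- |1/a - 1/b| ≤ ε follows from |b - a| ≤ δ²ε for a , b ≥ δ.
  1/₀-close : ∀ {δ a b ε} → 0ℚ ℚ.< δ → δ ℚ.≤ a → δ ℚ.≤ b → 0ℚ ℚ.≤ ε →
              ℚ.∣ b ℚ.- a ∣ ℚ.≤ (δ ℚ.* δ) ℚ.* ε → ℚ.∣ 1/₀ a ℚ.- 1/₀ b ∣ ℚ.≤ ε
  1/₀-close {δ} {a} {b} {ε} 0<δ δ≤a δ≤b 0≤ε h =
    ℚ.*-cancelˡ-≤-pos (a ℚ.* b) {{ℚ.positive 0<ab}} (begin
      (a ℚ.* b) ℚ.* ℚ.∣ 1/₀ a ℚ.- 1/₀ b ∣
        ≡⟨ cong (ℚ._* ℚ.∣ 1/₀ a ℚ.- 1/₀ b ∣) (ℚ.0≤p⇒∣p∣≡p (ℚ.<⇒≤ 0<ab)) ⟨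
      ℚ.∣ a ℚ.* b ∣ ℚ.* ℚ.∣ 1/₀ a ℚ.- 1/₀ b ∣
        ≡⟨ ℚ.∣p*q∣≡∣p∣*∣q∣ (a ℚ.* b) _ ⟨
      ℚ.∣ (a ℚ.* b) ℚ.* (1/₀ a ℚ.- 1/₀ b) ∣
        ≡⟨ cong ℚ.∣_∣ (regroup₅ a b (1/₀ a) (1/₀ b)) ⟩
      ℚ.∣ (a ℚ.* 1/₀ a) ℚ.* b ℚ.- (b ℚ.* 1/₀ b) ℚ.* a ∣
        ≡⟨ cong₂ (λ s t → ℚ.∣ s ℚ.* b ℚ.- t ℚ.* a ∣) (1/₀-inverse 0<a) (1/₀-inverse 0<b) ⟩
      ℚ.∣ 1ℚ ℚ.* b ℚ.- 1ℚ ℚ.* a ∣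
        ≡⟨ cong₂ (λ s t → ℚ.∣ s ℚ.- t ∣) (ℚ.*-identityˡ b) (ℚ.*-identityˡ a) ⟩
      ℚ.∣ b ℚ.- a ∣
        ≤⟨ h ⟩
      (δ ℚ.* δ) ℚ.* ε
        ≤⟨ ℚ.*-monoʳ-≤-nonNeg ε {{ℚ.nonNegative 0≤ε}}
             (*-mono {δ} {a} {δ} {b} (ℚ.<⇒≤ 0<δ) (ℚ.<⇒≤ 0<a) δ≤a δ≤b) ⟩
      (a ℚ.* b) ℚ.* ε ∎)
    where
    0<a : 0ℚ ℚ.< a
    0<a = ℚ.<-≤-trans 0<δ δ≤a
    0<b : 0ℚ ℚ.< b
    0<b = ℚ.<-≤-trans 0<δ δ≤b
    0<ab : 0ℚ ℚ.< a ℚ.* b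
    0<ab = 0<* {a} {b} 0<a 0<b

  inv-cauchy : (x : ℝ) → 0ℝ <ℝ x → IsCauchy (λ n → 1/₀ seq x n)
  inv-cauchy x (δ , 0<δ , K , δ≤) ε 0<ε
    with cauchy x ((δ ℚ.* δ) ℚ.* ε) (0<* {δ ℚ.* δ} {ε} (0<* {δ} {δ} 0<δ 0<δ) 0<ε)
  ... | N , f = K ℕ.⊔ N , λ m n hm hn →
    1/₀-close 0<δ (δ≤x m hm) (δ≤x n hn) (ℚ.<⇒≤ 0<ε)
      (f n m (ℕ.m⊔n≤o⇒n≤o K N hn) (ℕ.m⊔n≤o⇒n≤o K N hm))
    where
    δ≤x : ∀ i → K ℕ.⊔ N ℕ.≤ i → δ ℚ.≤ seq x i
    δ≤x i h = subst (ℚ._≤ seq x i) (ℚ.+-identityˡ δ) (δ≤ i (ℕ.m⊔n≤o⇒m≤o K N h))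

inverse : (x : ℝ) → 0ℝ <ℝ x → ℝ
inverse x 0<x = mkℝ (λ n → 1/₀ seq x n) (inv-cauchy x 0<x)

infixl 7 _÷ℝ_⟨_⟩

_÷ℝ_⟨_⟩ : (x y : ℝ) → 0ℝ <ℝ y → ℝ
x ÷ℝ y ⟨ 0<y ⟩ = x *ℝ inverse y 0<y

Σℝ : ∀ {n} → (Fin n → ℝ) → ℝ
Σℝ = foldr _+ℝ_ 0ℝ

Matrix : Set → ℕ → Set
Matrix R n = Fin n → Fin n → R

identity : ∀ {n} → Matrix ℚ n
identity v w = if does (v Fin.≟ w) then 1ℚ else 0ℚ

_·_ : ∀ {n} → Matrix ℚ n → (Fin n → ℝ) → (Fin n → ℝ)
(M · f) v = Σℝ λ w → fromℚ (M v w) *ℝ f w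

IsEigenvalue : ∀ {n} → Matrix ℚ n → ℝ → Set
IsEigenvalue {n} M μ = ∃ λ (f : Fin n → ℝ) →
  ¬ (∀ v → f v ≈ℝ 0ℝ) × (∀ v → (M · f) v ≈ℝ μ *ℝ f v)

IsSmallestEigenvalue : ∀ {n} → Matrix ℚ n → ℝ → Set
IsSmallestEigenvalue M μ =
  IsEigenvalue M μ × (∀ ν → IsEigenvalue M ν → μ ≤ℝ ν)

-- Unoriented: every incidence has orientation +1, so none is recorded.
-- Duplicate-freeness makes the list of edges a finite set of subsets.
record Hypergraph : Set where
  field
    order       : ℕ
    edges       : List (Subset order)
    edgesUnique : Unique edges

  Vertex : Set
  Vertex = Fin order

open Hypergraph public

IsUniform : ℕ → Hypergraph → Set
IsUniform c Γ = All (λ e → ∣ e ∣ ≡ c) (edges Γ)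

deg : (Γ : Hypergraph) → Vertex Γ → ℕ
deg Γ v = length (filter (v ∈?_) (edges Γ))

NoIsolatedVertices : Hypergraph → Set
NoIsolatedVertices Γ = ∀ v → 1 ℕ.≤ deg Γ v

codeg : (Γ : Hypergraph) → Vertex Γ → Vertex Γ → ℕ
codeg Γ v w = length (filter (λ e → (v ∈? e) ×-dec (w ∈? e)) (edges Γ))

adjacency : (Γ : Hypergraph) → Matrix ℤ (order Γ)
adjacency Γ v w =
  if does (v Fin.≟ w) then ℤ.+ 0 else ℤ.- (ℤ.+ codeg Γ v w)

-- Id − D⁻¹A, where D⁻¹ divides row v of A by deg v.
laplacian : (Γ : Hypergraph) → NoIsolatedVertices Γ → Matrix ℚ (order Γ)
laplacian Γ deg≥1 v w =
  identity v w ℚ.- ℚ._/_ (adjacency Γ v w) (deg Γ v) {{ℕ.>-nonZero (deg≥1 v)}}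

Coloring : Hypergraph → ℕ → Set
Coloring Γ k = Vertex Γ → Fin k

colorClass : (Γ : Hypergraph) {k : ℕ} → Coloring Γ k → Fin k → List (Vertex Γ)
colorClass Γ κ i = filter (λ w → κ w Fin.≟ i) (allFin (order Γ))

IsTailored : (Γ : Hypergraph) → ℝ → {k : ℕ} → Coloring Γ k → Set
IsTailored Γ q κ = ∀ i v → κ v ≡ i →
  fromℕ (sum (map (λ w → ℤ.∣ adjacency Γ v w ∣) (colorClass Γ κ i)))
    ≤ℝ q *ℝ fromℕ (deg Γ v)

HasTailoredColoring : Hypergraph → ℝ → ℕ → Set
HasTailoredColoring Γ q k = ∃ λ (κ : Coloring Γ k) → IsTailored Γ q κ

IsTailoredChromaticNumber : Hypergraph → ℝ → ℕ → Set
IsTailoredChromaticNumber Γ q χ =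
  HasTailoredColoring Γ q χ × (∀ k → HasTailoredColoring Γ q k → χ ℕ.≤ k)

{-# OPTIONS --safe #-}
module Submission where

-- Write S t = B - t D, where B is the matrix of codegrees and D that of degrees,
-- so that L = D⁻¹ B.  For a colouring with k classes Vᵢ, summing the quadratic form
-- of S t over the vectors k 1_{Vᵢ} - 1 and using the row sums c deg v of B shows
-- that t (k - 1) ≤ k (1 + q) - c whenever S t is positive semidefinite, which is
-- the bound with t in place of λ₁.
--
-- To pass to λ₁ constructively, semidefiniteness of a rational form is decided by
-- Schur complements, and bisection yields a real ν with rational approximations t
-- for which S t is alternately semidefinite and not.  Repeating the elimination on
-- the real matrix S ν, a pivot has to vanish (otherwise the approximations would
-- eventually all be definite), and then semidefiniteness kills the rest of its row,
-- giving a kernel vector.  Which pivot vanishes is not decidable, so ν is only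
-- ¬¬-shown to be an eigenvalue; this suffices because λ₁ ≤ ν is a stable statement.
--
-- Equality holds for a single edge on c vertices, where L is the all-ones matrix
-- and λ₁ = 0.
open import Defs
open import Data.Nat using (ℕ; zero; suc; _≤_; s≤s; z≤n)
import Data.Nat as ℕ
import Data.Nat.Properties as ℕ
open import Data.Nat.Divisibility using (_∣_; divides)
open import Data.Nat.ListAction using () renaming (sum to sumℕ)
import Data.Integer as ℤ
import Data.Integer.Properties as ℤ
open import Data.Rational as ℚ using (ℚ; 0ℚ; 1ℚ; ½; _+_; _*_; _-_; -_)
import Data.Rational.Properties as ℚ
open import Data.Rational.Solver using (module +-*-Solver)
import Data.Rational.Unnormalised as ℚᵘ
import Data.Rational.Unnormalised.Properties as ℚᵘ
open import Data.Bool using (Bool; true; false; _∧_; if_then_else_)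
open import Data.Fin using (Fin; zero; suc; _↑ˡ_; _↑ʳ_; quotient)
import Data.Fin as Fin
import Data.Fin.Properties as Fin
open import Data.Fin.Subset using (Subset; inside; outside; ∣_∣; ⊤)
open import Data.Fin.Subset.Properties using (_∈?_; ∈⊤; ∣⊤∣≡n)
open import Data.List as List using (List; []; _∷_; length; filter)
open import Data.List.Properties using (filter-accept)
open import Data.List.Relation.Unary.All using (All; []; _∷_)
import Data.List.Relation.Unary.AllPairs as AllPairs
import Data.Vec as Vec
open import Data.Vec.Functional using () renaming (_∷_ to _∷ᶠ_)
open import Data.Product using (Σ; Σ-syntax; ∃-syntax; ∃; _×_; _,_; proj₁; proj₂)
open import Data.Sum using (inj₁; inj₂)
open import Function using (id; _∘_)
open import Relation.Nullary using (¬_; Dec; yes; no; does; contradiction)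
open import Relation.Nullary.Decidable using (map′; _×-dec_; dec-true)
open import Relation.Unary using (Decidable)
open import Relation.Binary.Definitions using (tri<; tri≈; tri>)
open import Relation.Binary.PropositionalEquality using (_≡_; _≢_; refl; sym; trans; cong; cong₂; subst; subst₂; module ≡-Reasoning)
open import Algebra.Bundles using (CommutativeRing)
open import Algebra.Properties.Semiring.Sum (CommutativeRing.semiring ℚ.+-*-commutativeRing)
  using (sum; sum-cong-≗; ∑-distrib-+; ∑-comm; *-distribˡ-sum; sum-replicate-zero)

open +-*-Solver using (solve; _:+_; _:*_; _:-_; :-_; _:=_; con)

-- Rational inequalities

infixl 6 _⊕_
infixl 7 _⊗_

0≤1 : 0ℚ ℚ.≤ 1ℚ
0≤1 = ℚ.nonNegative⁻¹ 1ℚ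

0<1 : 0ℚ ℚ.< 1ℚ
0<1 = ℚ.positive⁻¹ 1ℚ

_⊕_ : ∀ {p q} → 0ℚ ℚ.≤ p → 0ℚ ℚ.≤ q → 0ℚ ℚ.≤ p + q
_⊕_ {p} {q} 0≤p 0≤q =
  ℚ.nonNegative⁻¹ _ {{ℚ.nonNeg+nonNeg⇒nonNeg p {{ℚ.nonNegative 0≤p}} q {{ℚ.nonNegative 0≤q}}}}

_⊗_ : ∀ {p q} → 0ℚ ℚ.≤ p → 0ℚ ℚ.≤ q → 0ℚ ℚ.≤ p * q
_⊗_ {p} {q} 0≤p 0≤q =
  ℚ.nonNegative⁻¹ _ {{ℚ.nonNeg*nonNeg⇒nonNeg p {{ℚ.nonNegative 0≤p}} q {{ℚ.nonNegative 0≤q}}}}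

0<p*q : ∀ {p q} → 0ℚ ℚ.< p → 0ℚ ℚ.< q → 0ℚ ℚ.< p * q
0<p*q {p} {q} 0<p 0<q =
  ℚ.positive⁻¹ _ {{ℚ.pos*pos⇒pos p {{ℚ.positive 0<p}} q {{ℚ.positive 0<q}}}}

≤⇒0≤- : ∀ {p q} → p ℚ.≤ q → 0ℚ ℚ.≤ q - p
≤⇒0≤- {p} {q} p≤q = subst (ℚ._≤ q - p) (ℚ.+-inverseʳ p) (ℚ.+-monoˡ-≤ (- p) p≤q)

≤-by : ∀ {p q r} → 0ℚ ℚ.≤ r → q ≡ p + r → p ℚ.≤ q
≤-by {p} {q} {r} 0≤r q≡p+r =
  subst₂ ℚ._≤_ (ℚ.+-identityʳ p) (sym q≡p+r) (ℚ.+-monoʳ-≤ p 0≤r)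

<⇒≱ : ∀ {p q} → p ℚ.< q → ¬ (q ℚ.≤ p)
<⇒≱ p<q q≤p = ℚ.<-irrefl refl (ℚ.<-≤-trans p<q q≤p)

0≤p*p : ∀ p → 0ℚ ℚ.≤ p * p
0≤p*p p with ℚ.≤-total 0ℚ p
... | inj₁ 0≤p = 0≤p ⊗ 0≤p
... | inj₂ p≤0 = subst (0ℚ ℚ.≤_) (solve 1 (λ p → (con 0ℚ :- p) :* (con 0ℚ :- p) := p :* p) refl p)
                   (≤⇒0≤- p≤0 ⊗ ≤⇒0≤- p≤0)

0<p⇒p*1/₀p≡1 : ∀ {p} → 0ℚ ℚ.< p → p * 1/₀ p ≡ 1ℚ
0<p⇒p*1/₀p≡1 {p} 0<p with p ℚ.≟ 0ℚ
... | yes p≡0 = contradiction (sym p≡0) (ℚ.<⇒≢ 0<p)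
... | no  p≢0 = ℚ.*-inverseʳ p {{ℚ.≢-nonZero p≢0}}

0<p⇒0<1/₀p : ∀ {p} → 0ℚ ℚ.< p → 0ℚ ℚ.< 1/₀ p
0<p⇒0<1/₀p {p} 0<p with p ℚ.≟ 0ℚ
... | yes p≡0 = contradiction (sym p≡0) (ℚ.<⇒≢ 0<p)
... | no  p≢0 = ℚ.positive⁻¹ (ℚ.1/_ p {{ℚ.≢-nonZero p≢0}}) {{ℚ.1/pos⇒pos p {{ℚ.positive 0<p}}}}

-- Finite sums

sum-zero : ∀ {n} {f : Fin n → ℚ} → (∀ i → f i ≡ 0ℚ) → sum f ≡ 0ℚ
sum-zero {n} f≡0 = trans (sum-cong-≗ f≡0) (sum-replicate-zero n)

sum-nonneg : ∀ {n} {f : Fin n → ℚ} → (∀ i → 0ℚ ℚ.≤ f i) → 0ℚ ℚ.≤ sum f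
sum-nonneg {zero}  0≤f = ℚ.≤-refl
sum-nonneg {suc n} 0≤f = 0≤f zero ⊕ sum-nonneg (λ i → 0≤f (suc i))

sum-scale : ∀ {n} c (f : Fin n → ℚ) → sum (λ i → c * f i) ≡ c * sum f
sum-scale c f = sym (*-distribˡ-sum c f)

sum-affine : ∀ {n} (f g : Fin n → ℚ) c → sum (λ i → f i - c * g i) ≡ sum f - c * sum g
sum-affine f g c = begin
  sum (λ i → f i - c * g i)       ≡⟨ sum-cong-≗ (λ i → cong (f i +_) (ℚ.neg-distribˡ-* c (g i))) ⟩
  sum (λ i → f i + (- c) * g i)   ≡⟨ ∑-distrib-+ f _ ⟩
  sum f + sum (λ i → - c * g i)   ≡⟨ cong (sum f +_) (sum-scale (- c) g) ⟩
  sum f + - c * sum g             ≡⟨ cong (sum f +_) (sym (ℚ.neg-distribˡ-* c (sum g))) ⟩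
  sum f - c * sum g               ∎
  where open ≡-Reasoning

identity-refl : ∀ {n} (i : Fin n) → identity i i ≡ 1ℚ
identity-refl i with i Fin.≟ i
... | yes _   = refl
... | no  i≢i = contradiction refl i≢i

identity-≢ : ∀ {n} {i j : Fin n} → i ≢ j → identity i j ≡ 0ℚ
identity-≢ {i = i} {j} i≢j with i Fin.≟ j
... | yes i≡j = contradiction i≡j i≢j
... | no  _   = refl

identity-sym : ∀ {n} (i j : Fin n) → identity i j ≡ identity j i
identity-sym i j with i Fin.≟ j
... | yes refl = sym (identity-refl i)
... | no  i≢j  = sym (identity-≢ (λ j≡i → i≢j (sym j≡i)))

identity-suc : ∀ {n} (i j : Fin n) → identity (suc i) (suc j) ≡ identity i j
identity-suc i j with i Fin.≟ j
... | yes _ = refl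
... | no  _ = refl

sum-identity : ∀ {n} i (f : Fin n → ℚ) → sum (λ j → identity i j * f j) ≡ f i
sum-identity {suc n} zero f = begin
  1ℚ * f zero + sum (λ j → 0ℚ * f (suc j)) ≡⟨ cong₂ _+_ (ℚ.*-identityˡ (f zero)) (sum-zero (λ j → ℚ.*-zeroˡ (f (suc j)))) ⟩
  f zero + 0ℚ                              ≡⟨ ℚ.+-identityʳ _ ⟩
  f zero                                   ∎
  where open ≡-Reasoning
sum-identity {suc n} (suc i) f = begin
  0ℚ * f zero + sum (λ j → identity (suc i) (suc j) * f (suc j))
    ≡⟨ cong₂ _+_ (ℚ.*-zeroˡ (f zero)) (sum-cong-≗ λ j → cong (_* f (suc j)) (identity-suc i j)) ⟩
  0ℚ + sum (λ j → identity i j * f (suc j))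
    ≡⟨ ℚ.+-identityˡ _ ⟩
  sum (λ j → identity i j * f (suc j))
    ≡⟨ sum-identity i (λ j → f (suc j)) ⟩
  f (suc i) ∎
  where open ≡-Reasoning

-- Positive semidefinite forms

Symmetric : ∀ {n} → Matrix ℚ n → Set
Symmetric S = ∀ i j → S i j ≡ S j i

apply : ∀ {n} → Matrix ℚ n → (Fin n → ℚ) → Fin n → ℚ
apply S x i = sum λ j → S i j * x j

quad : ∀ {n} → Matrix ℚ n → (Fin n → ℚ) → ℚ
quad S x = sum λ i → x i * apply S x i

PSD : ∀ {n} → Matrix ℚ n → Set
PSD S = ∀ x → 0ℚ ℚ.≤ quad S x

minor : ∀ {n} → Matrix ℚ (suc n) → Matrix ℚ n
minor S i j = S (suc i) (suc j)

cross : ∀ {n} → Matrix ℚ (suc n) → (Fin n → ℚ) → ℚ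
cross S x = sum λ j → S zero (suc j) * x j

-- Using the total `1/₀` defines the complement for every pivot, hence at every index of a real
-- matrix; positivity of the pivot enters only in the lemmas.
schur : ∀ {n} → Matrix ℚ (suc n) → Matrix ℚ n
schur S i j = S (suc i) (suc j) - S (suc i) zero * S zero (suc j) * 1/₀ S zero zero

schur-symmetric : ∀ {n} {S : Matrix ℚ (suc n)} → Symmetric S → Symmetric (schur S)
schur-symmetric {S = S} S-sym i j =
  cong₂ (λ c p → c - p * 1/₀ S zero zero) (S-sym (suc i) (suc j))
    (trans (cong₂ _*_ (S-sym (suc i) zero) (S-sym zero (suc j))) (ℚ.*-comm (S zero (suc i)) _))

quad-∷ : ∀ {n} {S : Matrix ℚ (suc n)} → Symmetric S → ∀ x₀ x →
         quad S (x₀ ∷ᶠ x) ≡ S zero zero * (x₀ * x₀) + (1ℚ + 1ℚ) * x₀ * cross S x + quad (minor S) x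
quad-∷ {S = S} S-sym x₀ x = begin
  x₀ * (a * x₀ + β) + sum (λ i → x i * (S (suc i) zero * x₀ + apply (minor S) x i))
    ≡⟨ cong (x₀ * (a * x₀ + β) +_) (sum-cong-≗ λ i → trans
         (cong (λ s → x i * (s * x₀ + apply (minor S) x i)) (S-sym (suc i) zero))
         (solve 4 (λ xi s x₀ m → xi :* (s :* x₀ :+ m) := x₀ :* (s :* xi) :+ xi :* m) refl
           (x i) (S zero (suc i)) x₀ (apply (minor S) x i))) ⟩
  x₀ * (a * x₀ + β) + sum (λ i → x₀ * (S zero (suc i) * x i) + x i * apply (minor S) x i)
    ≡⟨ cong (x₀ * (a * x₀ + β) +_) (trans (∑-distrib-+ (λ i → x₀ * (S zero (suc i) * x i)) _)
         (cong (_+ quad (minor S) x) (sum-scale x₀ (λ i → S zero (suc i) * x i)))) ⟩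
  x₀ * (a * x₀ + β) + (x₀ * β + quad (minor S) x)
    ≡⟨ solve 4 (λ x₀ a β m → x₀ :* (a :* x₀ :+ β) :+ (x₀ :* β :+ m) :=
         a :* (x₀ :* x₀) :+ (con 1ℚ :+ con 1ℚ) :* x₀ :* β :+ m) refl x₀ a β (quad (minor S) x) ⟩
  a * (x₀ * x₀) + (1ℚ + 1ℚ) * x₀ * β + quad (minor S) x ∎
  where
  open ≡-Reasoning
  a = S zero zero
  β = cross S x

apply-schur : ∀ {n} (S : Matrix ℚ (suc n)) x i →
  apply (schur S) x i ≡ apply (minor S) x i - S (suc i) zero * 1/₀ S zero zero * cross S x
apply-schur S x i = trans
  (sum-cong-≗ λ j → solve 5 (λ c s b v x → (c :- s :* b :* v) :* x := c :* x :- s :* v :* (b :* x)) refl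
    (S (suc i) (suc j)) (S (suc i) zero) (S zero (suc j)) (1/₀ S zero zero) (x j))
  (sum-affine (λ j → minor S i j * x j) (λ j → S zero (suc j) * x j) (S (suc i) zero * 1/₀ S zero zero))

-- For a positive pivot the head entry solves row zero of S y = 0, which is also where the form is
-- minimal in that coordinate.
schurLift : ∀ {n} → Matrix ℚ (suc n) → (Fin n → ℚ) → Fin (suc n) → ℚ
schurLift S x = - (1/₀ S zero zero * cross S x) ∷ᶠ x

apply-schurLift-zero : ∀ {n} (S : Matrix ℚ (suc n)) → 0ℚ ℚ.< S zero zero → ∀ x →
                       apply S (schurLift S x) zero ≡ 0ℚ
apply-schurLift-zero S 0<a x = begin
  a * - (v * β) + β  ≡⟨ solve 3 (λ a v β → a :* :- (v :* β) :+ β := β :- a :* v :* β) refl a v β ⟩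
  β - a * v * β      ≡⟨ cong (λ e → β - e * β) (0<p⇒p*1/₀p≡1 0<a) ⟩
  β - 1ℚ * β         ≡⟨ solve 1 (λ β → β :- con 1ℚ :* β := con 0ℚ) refl β ⟩
  0ℚ                 ∎
  where
  open ≡-Reasoning
  a = S zero zero
  v = 1/₀ S zero zero
  β = cross S x

apply-schurLift-suc : ∀ {n} (S : Matrix ℚ (suc n)) x i →
                      apply S (schurLift S x) (suc i) ≡ apply (schur S) x i
apply-schurLift-suc S x i = trans
  (solve 4 (λ s v β m → s :* :- (v :* β) :+ m := m :- s :* v :* β) refl
    (S (suc i) zero) (1/₀ S zero zero) (cross S x) (apply (minor S) x i))
  (sym (apply-schur S x i))

quad-schur : ∀ {n} {S : Matrix ℚ (suc n)} → Symmetric S → ∀ x →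
  quad (schur S) x ≡ quad (minor S) x - 1/₀ S zero zero * cross S x * cross S x
quad-schur {S = S} S-sym x = begin
  sum (λ i → x i * apply (schur S) x i)
    ≡⟨ sum-cong-≗ (λ i → trans
         (cong (x i *_) (trans (apply-schur S x i)
           (cong (λ s → apply (minor S) x i - s * v * β) (S-sym (suc i) zero))))
         (solve 5 (λ x m s v β → x :* (m :- s :* v :* β) := x :* m :- v :* β :* (s :* x)) refl
           (x i) (apply (minor S) x i) (S zero (suc i)) v β)) ⟩
  sum (λ i → x i * apply (minor S) x i - v * β * (S zero (suc i) * x i))
    ≡⟨ sum-affine (λ i → x i * apply (minor S) x i) (λ i → S zero (suc i) * x i) (v * β) ⟩
  quad (minor S) x - v * β * β ∎
  where
  open ≡-Reasoning
  v = 1/₀ S zero zero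
  β = cross S x

-- Completing the square in `x₀`: the shift β / a absorbs the linear term, and the leftover β² / a
-- is what the Schur complement subtracts.
quad-complete : ∀ {n} {S : Matrix ℚ (suc n)} → Symmetric S → 0ℚ ℚ.< S zero zero → ∀ x₀ x →
  let y = x₀ + 1/₀ S zero zero * cross S x in
  quad S (x₀ ∷ᶠ x) ≡ S zero zero * (y * y) + quad (schur S) x
quad-complete {S = S} S-sym 0<a x₀ x = begin
  quad S (x₀ ∷ᶠ x)
    ≡⟨ quad-∷ S-sym x₀ x ⟩
  a * (x₀ * x₀) + (1ℚ + 1ℚ) * x₀ * β + m
    -- Factors `1ℚ` are inserted exactly where a v is substituted next, after which the identity is
    -- polynomial.
    ≡⟨ solve 5 (λ a x₀ β m v →
         a :* (x₀ :* x₀) :+ (con 1ℚ :+ con 1ℚ) :* x₀ :* β :+ m :=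
         (a :* (x₀ :* x₀) :+ (con 1ℚ :+ con 1ℚ) :* x₀ :* (con 1ℚ :* β)
           :+ v :* con 1ℚ :* β :* β) :+ (m :- v :* β :* β)) refl a x₀ β m v ⟩
  (a * (x₀ * x₀) + (1ℚ + 1ℚ) * x₀ * (1ℚ * β) + v * 1ℚ * β * β) + (m - v * β * β)
    ≡⟨ cong₂ (λ e q → (a * (x₀ * x₀) + (1ℚ + 1ℚ) * x₀ * (e * β) + v * e * β * β) + q)
         (sym (0<p⇒p*1/₀p≡1 0<a)) (sym (quad-schur S-sym x)) ⟩
  (a * (x₀ * x₀) + (1ℚ + 1ℚ) * x₀ * (a * v * β) + v * (a * v) * β * β) + quad (schur S) x
    ≡⟨ cong (_+ quad (schur S) x) (solve 4 (λ a x₀ β v →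
         a :* (x₀ :* x₀) :+ (con 1ℚ :+ con 1ℚ) :* x₀ :* (a :* v :* β) :+ v :* (a :* v) :* β :* β :=
         a :* ((x₀ :+ v :* β) :* (x₀ :+ v :* β))) refl a x₀ β v) ⟩
  a * ((x₀ + v * β) * (x₀ + v * β)) + quad (schur S) x ∎
  where
  open ≡-Reasoning
  a = S zero zero
  v = 1/₀ S zero zero
  β = cross S x
  m = quad (minor S) x

quad-cong : ∀ {n} (S : Matrix ℚ n) x y → (∀ i → x i ≡ y i) → quad S x ≡ quad S y
quad-cong S x y x≗y = sum-cong-≗ λ i → cong₂ _*_ (x≗y i) (sum-cong-≗ λ j → cong (S i j *_) (x≗y j))

quad-head-tail : ∀ {n} (S : Matrix ℚ (suc n)) x → quad S x ≡ quad S (x zero ∷ᶠ λ i → x (suc i))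
quad-head-tail S x = quad-cong S x (x zero ∷ᶠ λ i → x (suc i)) λ where
  zero    → refl
  (suc i) → refl

-- At the head value - β / a the completed square vanishes and only the Schur form remains.
PSD⇒PSD-schur : ∀ {n} {S : Matrix ℚ (suc n)} → Symmetric S → 0ℚ ℚ.< S zero zero →
                PSD S → PSD (schur S)
PSD⇒PSD-schur {S = S} S-sym 0<a psd x = subst (0ℚ ℚ.≤_)
  (trans (quad-complete S-sym 0<a (- (v * β)) x)
    (solve 4 (λ a v β s → a :* ((:- (v :* β) :+ v :* β) :* (:- (v :* β) :+ v :* β)) :+ s := s) refl
      (S zero zero) v β (quad (schur S) x)))
  (psd (- (v * β) ∷ᶠ x))
  where
  v = 1/₀ S zero zero
  β = cross S x

PSD-schur⇒PSD : ∀ {n} {S : Matrix ℚ (suc n)} → Symmetric S → 0ℚ ℚ.< S zero zero →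
                PSD (schur S) → PSD S
PSD-schur⇒PSD {S = S} S-sym 0<a psd x = subst (0ℚ ℚ.≤_)
  (sym (trans (quad-head-tail S x) (quad-complete S-sym 0<a (x zero) (λ i → x (suc i)))))
  (ℚ.<⇒≤ 0<a ⊗ 0≤p*p (x zero + 1/₀ S zero zero * cross S (λ i → x (suc i))) ⊕ psd (λ i → x (suc i)))

PSD⇒PSD-minor : ∀ {n} {S : Matrix ℚ (suc n)} → Symmetric S → PSD S → PSD (minor S)
PSD⇒PSD-minor {S = S} S-sym psd x = subst (0ℚ ℚ.≤_)
  (trans (quad-∷ S-sym 0ℚ x)
    (solve 3 (λ a β m → a :* (con 0ℚ :* con 0ℚ) :+ (con 1ℚ :+ con 1ℚ) :* con 0ℚ :* β :+ m := m) refl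
      (S zero zero) (cross S x) (quad (minor S) x)))
  (psd (0ℚ ∷ᶠ x))

apply-identity : ∀ {n} (S : Matrix ℚ n) i j → apply S (identity j) i ≡ S i j
apply-identity S i j = trans (sum-cong-≗ λ k → ℚ.*-comm (S i k) _) (sum-identity j (S i))

quad-identity : ∀ {n} (S : Matrix ℚ n) j → quad S (identity j) ≡ S j j
quad-identity S j = trans (sum-identity j (apply S (identity j))) (apply-identity S j j)

PSD⇒0≤diagonal : ∀ {n} {S : Matrix ℚ n} → PSD S → ∀ j → 0ℚ ℚ.≤ S j j
PSD⇒0≤diagonal {S = S} psd j = subst (0ℚ ℚ.≤_) (quad-identity S j) (psd (identity j))

-- The form is evaluated at the vector with entries - s b at 0 and 1 at j + 1.
PSD⇒s*b²≤c : ∀ {n} {S : Matrix ℚ (suc n)} → Symmetric S → PSD S → ∀ j s → 0ℚ ℚ.≤ s →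
  S zero zero * s ℚ.≤ 1ℚ → s * (S zero (suc j) * S zero (suc j)) ℚ.≤ S (suc j) (suc j)
PSD⇒s*b²≤c {S = S} S-sym psd j s 0≤s as≤1 = ≤-by
  (subst (0ℚ ℚ.≤_) form (psd (- (s * b) ∷ᶠ identity j)) ⊕ ≤⇒0≤- as≤1 ⊗ (0≤s ⊗ 0≤p*p b))
  (solve 4 (λ a s b c → c := s :* (b :* b) :+
    ((a :* (:- (s :* b) :* :- (s :* b)) :+ (con 1ℚ :+ con 1ℚ) :* :- (s :* b) :* b :+ c) :+
     (con 1ℚ :- a :* s) :* (s :* (b :* b)))) refl a s b c)
  where
  a = S zero zero
  b = S zero (suc j)
  c = S (suc j) (suc j)
  form : quad S (- (s * b) ∷ᶠ identity j) ≡ a * (- (s * b) * - (s * b)) + (1ℚ + 1ℚ) * - (s * b) * b + c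
  form = trans (quad-∷ S-sym (- (s * b)) (identity j))
    (cong₂ (λ β m → a * (- (s * b) * - (s * b)) + (1ℚ + 1ℚ) * - (s * b) * β + m)
      (trans (sum-cong-≗ λ k → ℚ.*-comm (S zero (suc k)) (identity j k)) (sum-identity j (λ k → S zero (suc k))))
      (quad-identity (minor S) j))

p*p≡0⇒p≡0 : ∀ p → p * p ≡ 0ℚ → p ≡ 0ℚ
p*p≡0⇒p≡0 p p²≡0 with p ℚ.≟ 0ℚ
... | yes p≡0 = p≡0
... | no  p≢0 = begin
  p                 ≡⟨ ℚ.*-identityˡ p ⟨
  1ℚ * p            ≡⟨ cong (_* p) (ℚ.*-inverseˡ p) ⟨
  (ℚ.1/ p * p) * p  ≡⟨ ℚ.*-assoc (ℚ.1/ p) p p ⟩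
  ℚ.1/ p * (p * p)  ≡⟨ cong (ℚ.1/ p *_) p²≡0 ⟩
  ℚ.1/ p * 0ℚ       ≡⟨ ℚ.*-zeroʳ (ℚ.1/ p) ⟩
  0ℚ                ∎
  where
  open ≡-Reasoning
  instance _ = ℚ.≢-nonZero p≢0

-- With a zero pivot the bound s b² ≤ c holds for every s ≥ 0, which is impossible unless b = 0.
PSD⇒offDiagonal≡0 : ∀ {n} {S : Matrix ℚ (suc n)} → Symmetric S → S zero zero ≡ 0ℚ → PSD S →
                    ∀ j → S zero (suc j) ≡ 0ℚ
PSD⇒offDiagonal≡0 {S = S} S-sym a≡0 psd j with ℚ.<-cmp 0ℚ (b * b)
  where b = S zero (suc j)
... | tri≈ _ 0≡b² _ = p*p≡0⇒p≡0 _ (sym 0≡b²)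
... | tri> _ _ b²<0 = contradiction (0≤p*p (S zero (suc j))) (<⇒≱ b²<0)
... | tri< 0<b² _ _ = contradiction
  (subst (ℚ._≤ c) s*b² (PSD⇒s*b²≤c {S = S} S-sym psd j s 0≤s
    (subst (ℚ._≤ 1ℚ) (sym (trans (cong (_* s) a≡0) (ℚ.*-zeroˡ s))) 0≤1)))
  (<⇒≱ (subst (ℚ._< c + 1ℚ) (ℚ.+-identityʳ c) (ℚ.+-monoʳ-< c 0<1)))
  where
  b = S zero (suc j)
  c = S (suc j) (suc j)
  -- Chosen so that s b² = c + 1 exceeds c.
  s = (c + 1ℚ) * 1/₀ (b * b)
  0≤s : 0ℚ ℚ.≤ s
  0≤s = (PSD⇒0≤diagonal {S = S} psd (suc j) ⊕ 0≤1) ⊗ ℚ.<⇒≤ (0<p⇒0<1/₀p 0<b²)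
  s*b² : s * (b * b) ≡ c + 1ℚ
  s*b² = begin
    (c + 1ℚ) * 1/₀ (b * b) * (b * b)   ≡⟨ ℚ.*-assoc (c + 1ℚ) _ _ ⟩
    (c + 1ℚ) * (1/₀ (b * b) * (b * b)) ≡⟨ cong ((c + 1ℚ) *_) (trans (ℚ.*-comm _ (b * b)) (0<p⇒p*1/₀p≡1 0<b²)) ⟩
    (c + 1ℚ) * 1ℚ                      ≡⟨ ℚ.*-identityʳ _ ⟩
    c + 1ℚ                             ∎
    where open ≡-Reasoning

PSD-minor⇒PSD : ∀ {n} {S : Matrix ℚ (suc n)} → Symmetric S → S zero zero ≡ 0ℚ →
                (∀ j → S zero (suc j) ≡ 0ℚ) → PSD (minor S) → PSD S
PSD-minor⇒PSD {S = S} S-sym a≡0 b≡0 psd x = subst (0ℚ ℚ.≤_) (sym (begin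
  quad S x
    ≡⟨ quad-head-tail S x ⟩
  quad S (x zero ∷ᶠ x')
    ≡⟨ quad-∷ S-sym (x zero) x' ⟩
  S zero zero * (x zero * x zero) + (1ℚ + 1ℚ) * x zero * cross S x' + quad (minor S) x'
    ≡⟨ cong₂ (λ a β → a * (x zero * x zero) + (1ℚ + 1ℚ) * x zero * β + quad (minor S) x') a≡0
         (sum-zero λ j → trans (cong (_* x' j) (b≡0 j)) (ℚ.*-zeroˡ (x' j))) ⟩
  0ℚ * (x zero * x zero) + (1ℚ + 1ℚ) * x zero * 0ℚ + quad (minor S) x'
    ≡⟨ solve 2 (λ y m → con 0ℚ :* (y :* y) :+ (con 1ℚ :+ con 1ℚ) :* y :* con 0ℚ :+ m := m) refl
         (x zero) (quad (minor S) x') ⟩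
  quad (minor S) x' ∎)) (psd x')
  where
  open ≡-Reasoning
  x' : _ → ℚ
  x' i = x (suc i)

-- Symmetric elimination: a positive pivot passes to the Schur complement, a negative one refutes,
-- and a zero one must have a zero row before passing to the minor.
PSD? : ∀ {n} {S : Matrix ℚ n} → Symmetric S → Dec (PSD S)
PSD? {zero}          S-sym = yes λ _ → ℚ.≤-refl
PSD? {suc n} {S = S} S-sym with ℚ.<-cmp 0ℚ (S zero zero)
... | tri< 0<a _ _ = map′ (PSD-schur⇒PSD {S = S} S-sym 0<a) (PSD⇒PSD-schur {S = S} S-sym 0<a)
                       (PSD? (schur-symmetric {S = S} S-sym))
... | tri> _ _ a<0 = no λ psd → <⇒≱ a<0 (PSD⇒0≤diagonal {S = S} psd zero)
... | tri≈ _ 0≡a _ with Fin.all? (λ j → S zero (suc j) ℚ.≟ 0ℚ)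
...   | no  b≢0 = no λ psd → b≢0 (PSD⇒offDiagonal≡0 {S = S} S-sym (sym 0≡a) psd)
...   | yes b≡0 = map′ (PSD-minor⇒PSD {S = S} S-sym (sym 0≡a) b≡0) (PSD⇒PSD-minor {S = S} S-sym)
                    (PSD? (λ i j → S-sym (suc i) (suc j)))

-- Absolute values and error bounds.

p≤∣p∣ : ∀ p → p ℚ.≤ ℚ.∣ p ∣
p≤∣p∣ p with ℚ.≤-total 0ℚ p
... | inj₁ 0≤p = ℚ.≤-reflexive (sym (ℚ.0≤p⇒∣p∣≡p 0≤p))
... | inj₂ p≤0 = ℚ.≤-trans p≤0 (ℚ.0≤∣p∣ p)

-p≤∣p∣ : ∀ p → - p ℚ.≤ ℚ.∣ p ∣
-p≤∣p∣ p = subst (- p ℚ.≤_) (ℚ.∣-p∣≡∣p∣ p) (p≤∣p∣ (- p))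

∣p∣≤ : ∀ {p ε} → p ℚ.≤ ε → - p ℚ.≤ ε → ℚ.∣ p ∣ ℚ.≤ ε
∣p∣≤ {p} {ε} p≤ε -p≤ε with ℚ.∣p∣≡p∨∣p∣≡-p p
... | inj₁ eq = subst (ℚ._≤ ε) (sym eq) p≤ε
... | inj₂ eq = subst (ℚ._≤ ε) (sym eq) -p≤ε

∣p-q∣≤ε⇒p≤q+ε : ∀ p q {ε} → ℚ.∣ p - q ∣ ℚ.≤ ε → p ℚ.≤ q + ε
∣p-q∣≤ε⇒p≤q+ε p q {ε} h = ≤-by (≤⇒0≤- (ℚ.≤-trans (p≤∣p∣ (p - q)) h))
  (solve 3 (λ p q ε → q :+ ε := p :+ (ε :- (p :- q))) refl p q ε)

∣p-q∣≤ε⇒q≤p+ε : ∀ p q {ε} → ℚ.∣ p - q ∣ ℚ.≤ ε → q ℚ.≤ p + ε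
∣p-q∣≤ε⇒q≤p+ε p q {ε} h = ≤-by (≤⇒0≤- (ℚ.≤-trans (-p≤∣p∣ (p - q)) h))
  (solve 3 (λ p q ε → p :+ ε := q :+ (ε :- :- (p :- q))) refl p q ε)

≤+⇒∣p-q∣≤ : ∀ p q {ε} → p ℚ.≤ q + ε → q ℚ.≤ p + ε → ℚ.∣ p - q ∣ ℚ.≤ ε
≤+⇒∣p-q∣≤ p q {ε} p≤ q≤ = ∣p∣≤
  (≤-by (≤⇒0≤- p≤) (solve 3 (λ p q ε → ε := (p :- q) :+ ((q :+ ε) :- p)) refl p q ε))
  (≤-by (≤⇒0≤- q≤) (solve 3 (λ p q ε → ε := :- (p :- q) :+ ((p :+ ε) :- q)) refl p q ε))

0≤ε∧p*p≤ε*ε⇒∣p∣≤ε : ∀ p {ε} → 0ℚ ℚ.≤ ε → p * p ℚ.≤ ε * ε → ℚ.∣ p ∣ ℚ.≤ ε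
0≤ε∧p*p≤ε*ε⇒∣p∣≤ε p {ε} 0≤ε p²≤ε² = ℚ.≮⇒≥ λ ε<∣p∣ →
  <⇒≱ (ℚ.≤-<-trans
    (ℚ.*-monoˡ-≤-nonNeg ε {{ℚ.nonNegative 0≤ε}} (ℚ.<⇒≤ ε<∣p∣))
    (ℚ.*-monoˡ-<-pos ℚ.∣ p ∣ {{ℚ.positive (ℚ.≤-<-trans 0≤ε ε<∣p∣)}} ε<∣p∣))
    (subst (ℚ._≤ ε * ε) (trans (sym (ℚ.0≤p⇒∣p∣≡p (0≤p*p p))) (ℚ.∣p*q∣≡∣p∣*∣q∣ p p)) p²≤ε²)

0<½*ε : ∀ {ε} → 0ℚ ℚ.< ε → 0ℚ ℚ.< ½ * ε
0<½*ε = 0<p*q (ℚ.positive⁻¹ ½)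

p<p+ε : ∀ p {ε} → 0ℚ ℚ.< ε → p ℚ.< p + ε
p<p+ε p {ε} 0<ε = subst (ℚ._< p + ε) (ℚ.+-identityʳ p) (ℚ.+-monoʳ-< p 0<ε)

-- Natural numbers as rationals

ι : ℕ → ℚ
ι n = ℤ.+ n ℚ./ 1

toℚᵘ-ι : ∀ n → ℚ.toℚᵘ (ι n) ℚᵘ.≃ ℚᵘ.mkℚᵘ (ℤ.+ n) 0
toℚᵘ-ι n = ℚ.toℚᵘ-fromℚᵘ (ℚᵘ.mkℚᵘ (ℤ.+ n) 0)

ι-+ : ∀ m n → ι (m ℕ.+ n) ≡ ι m + ι n
ι-+ m n = ℚ.toℚᵘ-injective (begin
  ℚ.toℚᵘ (ι (m ℕ.+ n))                               ≈⟨ toℚᵘ-ι (m ℕ.+ n) ⟩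
  ℚᵘ.mkℚᵘ (ℤ.+ (m ℕ.+ n)) 0                          ≈⟨ ℚᵘ.*≡* (cong (ℤ._* ℤ.+ 1) (sym (cong₂ ℤ._+_ (ℤ.*-identityʳ (ℤ.+ m)) (ℤ.*-identityʳ (ℤ.+ n))))) ⟩
  ℚᵘ.mkℚᵘ (ℤ.+ m) 0 ℚᵘ.+ ℚᵘ.mkℚᵘ (ℤ.+ n) 0           ≈⟨ ℚᵘ.+-cong (toℚᵘ-ι m) (toℚᵘ-ι n) ⟨
  ℚ.toℚᵘ (ι m) ℚᵘ.+ ℚ.toℚᵘ (ι n)                     ≈⟨ ℚ.toℚᵘ-homo-+ (ι m) (ι n) ⟨
  ℚ.toℚᵘ (ι m + ι n)                                 ∎)
  where open ℚᵘ.≃-Reasoning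

ι-* : ∀ m n → ι (m ℕ.* n) ≡ ι m * ι n
ι-* zero    n = sym (ℚ.*-zeroˡ (ι n))
ι-* (suc m) n = begin
  ι (n ℕ.+ m ℕ.* n)     ≡⟨ ι-+ n (m ℕ.* n) ⟩
  ι n + ι (m ℕ.* n)     ≡⟨ cong (ι n +_) (ι-* m n) ⟩
  ι n + ι m * ι n       ≡⟨ solve 2 (λ m n → n :+ m :* n := (con 1ℚ :+ m) :* n) refl (ι m) (ι n) ⟩
  (1ℚ + ι m) * ι n      ≡⟨ cong (_* ι n) (ι-+ 1 m) ⟨
  ι (suc m) * ι n       ∎
  where open ≡-Reasoning

0≤ι : ∀ n → 0ℚ ℚ.≤ ι n
0≤ι n = ℚ.nonNegative⁻¹ (ι n) {{ℚ.normalize-nonNeg n 1}}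

ι-mono : ∀ {m n} → m ≤ n → ι m ℚ.≤ ι n
ι-mono {m} {n} m≤n = ≤-by (0≤ι (n ℕ.∸ m)) (trans (cong ι (sym (ℕ.m+[n∸m]≡n m≤n))) (ι-+ m (n ℕ.∸ m)))

p≤ι∣↥p∣ : ∀ p → p ℚ.≤ ι ℤ.∣ ℚ.↥ p ∣
p≤ι∣↥p∣ p@(ℚ.mkℚ _ _ _) = ℚ.toℚᵘ-cancel-≤ (ℚᵘ.≤-respʳ-≃ (ℚᵘ.≃-sym (toℚᵘ-ι ℤ.∣ ℚ.↥ p ∣)) (ℚᵘ.*≤* (bound (ℚ.↥ p))))
  where
  bound : ∀ z → z ℤ.* ℤ.+ 1 ℤ.≤ ℤ.+ ℤ.∣ z ∣ ℤ.* ℚ.↧ p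
  bound (ℤ.+ m) = ℤ.*-monoˡ-≤-nonNeg (ℤ.+ m) (ℤ.+≤+ (s≤s z≤n))
  bound ℤ.-[1+ m ] = ℤ.-≤+

2^_ : ℕ → ℚ
2^ zero  = 1ℚ
2^ suc k = 2^ k + 2^ k

1≤2^ : ∀ k → 1ℚ ℚ.≤ 2^ k
1≤2^ zero    = ℚ.≤-refl
1≤2^ (suc k) = ≤-by (≤⇒0≤- (1≤2^ k) ⊕ (0≤1 ⊕ ≤⇒0≤- (1≤2^ k)))
  (solve 1 (λ p → p :+ p := con 1ℚ :+ ((p :- con 1ℚ) :+ (con 1ℚ :+ (p :- con 1ℚ)))) refl (2^ k))

ι≤2^ : ∀ k → ι k ℚ.≤ 2^ k
ι≤2^ zero    = 0≤1
ι≤2^ (suc k) = subst (ℚ._≤ 2^ suc k) (sym (ι-+ 1 k)) (ℚ.+-mono-≤ (1≤2^ k) (ι≤2^ k))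

p*1/₀q*q≡p : ∀ p q → 0ℚ ℚ.< q → p * 1/₀ q * q ≡ p
p*1/₀q*q≡p p q 0<q = begin
  p * 1/₀ q * q   ≡⟨ ℚ.*-assoc p (1/₀ q) q ⟩
  p * (1/₀ q * q) ≡⟨ cong (p *_) (trans (ℚ.*-comm (1/₀ q) q) (0<p⇒p*1/₀p≡1 0<q)) ⟩
  p * 1ℚ          ≡⟨ ℚ.*-identityʳ p ⟩
  p               ∎
  where open ≡-Reasoning

archimedean : ∀ p {ε} → 0ℚ ℚ.< ε → ∃ λ k → p ℚ.≤ 2^ k * ε
archimedean p {ε} 0<ε = k , subst (ℚ._≤ 2^ k * ε) (p*1/₀q*q≡p p ε 0<ε)
  (ℚ.*-monoʳ-≤-nonNeg ε {{ℚ.nonNegative (ℚ.<⇒≤ 0<ε)}} (ℚ.≤-trans (p≤ι∣↥p∣ (p * 1/₀ ε)) (ι≤2^ k)))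
  where
  -- The absolute value of the numerator bounds p / ε, and k ≤ 2ᵏ.
  k = ℤ.∣ ℚ.↥ (p * 1/₀ ε) ∣

-- Order on the reals

Frequently : (ℕ → Set) → Set
Frequently P = ∀ N → ∃ λ n → N ≤ n × P n

frequently∧eventually : ∀ {P Q R : ℕ → Set} → (∀ n → P n → Q n → R n) →
                        Frequently P → Eventually Q → Frequently R
frequently∧eventually f freq (K , q) N with freq (N ℕ.⊔ K)
... | n , N⊔K≤n , p = n , ℕ.m⊔n≤o⇒m≤o N K N⊔K≤n , f n p (q n (ℕ.m⊔n≤o⇒n≤o N K N⊔K≤n))

eventually-∧ : ∀ {P Q R : ℕ → Set} → (∀ n → P n → Q n → R n) →
               Eventually P → Eventually Q → Eventually R
eventually-∧ f (M , p) (N , q) = M ℕ.⊔ N , λ n M⊔N≤n →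
  f n (p n (ℕ.m⊔n≤o⇒m≤o M N M⊔N≤n)) (q n (ℕ.m⊔n≤o⇒n≤o M N M⊔N≤n))

-- By the Cauchy property one comparison at a late index carries over to all later indices, at a
-- cost of ε / 2 for each sequence.
frequently-≤⇒≤ℝ : ∀ x y → Frequently (λ n → seq x n ℚ.≤ seq y n) → x ≤ℝ y
frequently-≤⇒≤ℝ x y freq ε 0<ε =
  let M , f = cauchy x (½ * ε) (0<½*ε 0<ε)
      N , g = cauchy y (½ * ε) (0<½*ε 0<ε)
      m , M⊔N≤m , xm≤ym = freq (M ℕ.⊔ N)
      M≤m = ℕ.m⊔n≤o⇒m≤o M N M⊔N≤m
      N≤m = ℕ.m⊔n≤o⇒n≤o M N M⊔N≤m
  in M ℕ.⊔ N , λ n h → ≤-by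
       (≤⇒0≤- (∣p-q∣≤ε⇒p≤q+ε (seq x n) (seq x m) (f n m (ℕ.m⊔n≤o⇒m≤o M N h) M≤m))
         ⊕ ≤⇒0≤- xm≤ym
         ⊕ ≤⇒0≤- (∣p-q∣≤ε⇒q≤p+ε (seq y n) (seq y m) (g n m (ℕ.m⊔n≤o⇒n≤o M N h) N≤m)))
       (solve 5 (λ xn xm yn ym ε → yn :+ ε := xn :+
           ((((xm :+ con ½ :* ε) :- xn) :+ (ym :- xm)) :+ ((yn :+ con ½ :* ε) :- ym))) refl
         (seq x n) (seq x m) (seq y n) (seq y m) ε)

-- A rational comparison at one late index K is decidable: one outcome gives the conclusion, the
-- other a witness of y < x.
≮ℝ⇒≥ℝ : ∀ x y → ¬ (y <ℝ x) → x ≤ℝ y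
≮ℝ⇒≥ℝ x y y≮x ε 0<ε = result
  where
  -- Moving between the indices n and K costs η on each side: 3η + 2η = ε in the first case, and 3η
  -- - 2η = η is left as the strict gap in the second.
  ⅕ = ℤ.+ 1 ℚ./ 5
  η = ⅕ * ε
  0<η : 0ℚ ℚ.< η
  0<η = 0<p*q (ℚ.positive⁻¹ ⅕) 0<ε
  M = proj₁ (cauchy x η 0<η)
  N = proj₁ (cauchy y η 0<η)
  K = M ℕ.⊔ N
  x-close : ∀ n → K ≤ n → ℚ.∣ seq x n - seq x K ∣ ℚ.≤ η
  x-close n K≤n = proj₂ (cauchy x η 0<η) n K (ℕ.m⊔n≤o⇒m≤o M N K≤n) (ℕ.m≤m⊔n M N)
  y-close : ∀ n → K ≤ n → ℚ.∣ seq y n - seq y K ∣ ℚ.≤ η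
  y-close n K≤n = proj₂ (cauchy y η 0<η) n K (ℕ.m⊔n≤o⇒n≤o M N K≤n) (ℕ.m≤n⊔m M N)
  result : Eventually λ n → seq x n ℚ.≤ seq y n + ε
  result with ℚ.≤-total (seq x K) (seq y K + (η + η + η))
  ... | inj₁ xK≤yK+3η = K , λ n K≤n → ≤-by
    (≤⇒0≤- (∣p-q∣≤ε⇒p≤q+ε (seq x n) (seq x K) (x-close n K≤n))
      ⊕ ≤⇒0≤- xK≤yK+3η
      ⊕ ≤⇒0≤- (∣p-q∣≤ε⇒q≤p+ε (seq y n) (seq y K) (y-close n K≤n)))
    (solve 5 (λ xn xk yn yk ε → let η = con ⅕ :* ε in yn :+ ε := xn :+
        ((((xk :+ η) :- xn) :+ ((yk :+ (η :+ η :+ η)) :- xk)) :+ ((yn :+ η) :- yk))) refl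
      (seq x n) (seq x K) (seq y n) (seq y K) ε)
  ... | inj₂ yK+3η≤xK = contradiction
    (η , 0<η , K , λ n K≤n → ≤-by
      (≤⇒0≤- (∣p-q∣≤ε⇒q≤p+ε (seq x n) (seq x K) (x-close n K≤n))
        ⊕ ≤⇒0≤- yK+3η≤xK
        ⊕ ≤⇒0≤- (∣p-q∣≤ε⇒p≤q+ε (seq y n) (seq y K) (y-close n K≤n)))
      (solve 5 (λ xn xk yn yk η → xn := (yn :+ η) :+
          ((((xn :+ η) :- xk) :+ (xk :- (yk :+ (η :+ η :+ η)))) :+ ((yk :+ η) :- yn))) refl
        (seq x n) (seq x K) (seq y n) (seq y K) η))
    y≮x

-- The order follows from the negation of the reverse strict order, and negations are stable.
≤ℝ-stable : ∀ x y → ¬ ¬ (x ≤ℝ y) → x ≤ℝ y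
≤ℝ-stable x y ¬¬x≤y = ≮ℝ⇒≥ℝ x y λ (ε , 0<ε , y+ε≤x) → ¬¬x≤y λ x≤y →
  let N , absurd = eventually-∧ {R = λ n → ¬ (0ℚ ℚ.≤ 0ℚ)}
        (λ n y+ε≤x x≤y+½ε _ → <⇒≱ (0<½*ε 0<ε) (≤-by
          (≤⇒0≤- y+ε≤x ⊕ ≤⇒0≤- x≤y+½ε)
          (solve 3 (λ x y ε → con 0ℚ := con ½ :* ε :+ ((x :- (y :+ ε)) :+ ((y :+ con ½ :* ε) :- x))) refl
            (seq x n) (seq y n) ε)))
        y+ε≤x (x≤y (½ * ε) (0<½*ε 0<ε))
  in absurd N ℕ.≤-refl ℚ.≤-refl

≤ℝ-trans : ∀ {x y z} → x ≤ℝ y → y ≤ℝ z → x ≤ℝ z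
≤ℝ-trans {x} {y} {z} x≤y y≤z ε 0<ε = eventually-∧
  (λ n p q → ≤-by (≤⇒0≤- p ⊕ ≤⇒0≤- q)
    (solve 4 (λ x y z ε → z :+ ε := x :+ (((y :+ con ½ :* ε) :- x) :+ ((z :+ con ½ :* ε) :- y))) refl
      (seq x n) (seq y n) (seq z n) ε))
  (x≤y (½ * ε) (0<½*ε 0<ε)) (y≤z (½ * ε) (0<½*ε 0<ε))

≤ℝ-antisym : ∀ {x y} → x ≤ℝ y → y ≤ℝ x → x ≈ℝ y
≤ℝ-antisym {x} {y} x≤y y≤x ε 0<ε =
  eventually-∧ (λ n → ≤+⇒∣p-q∣≤ (seq x n) (seq y n)) (x≤y ε 0<ε) (y≤x ε 0<ε)

≈ℝ0-resp : ∀ x y → Eventually (λ n → seq x n ≡ seq y n) → y ≈ℝ 0ℝ → x ≈ℝ 0ℝ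
≈ℝ0-resp x y x≗y y≈0 ε 0<ε =
  eventually-∧ (λ n xn≡yn → subst (λ p → ℚ.∣ p - 0ℚ ∣ ℚ.≤ ε) (sym xn≡yn)) x≗y (y≈0 ε 0<ε)

frequently-small⇒≈ℝ0 : ∀ x → (∀ ε → 0ℚ ℚ.< ε → Frequently λ n → ℚ.∣ seq x n ∣ ℚ.≤ ε) → x ≈ℝ 0ℝ
frequently-small⇒≈ℝ0 x small ε 0<ε =
  let N , f = cauchy x (½ * ε) (0<½*ε 0<ε)
      m , N≤m , xm≤ = small (½ * ε) (0<½*ε 0<ε) N
  in N , λ n N≤n → begin
    ℚ.∣ seq x n - 0ℚ ∣
      ≡⟨ cong ℚ.∣_∣ (solve 2 (λ a b → a :- con 0ℚ := (a :- b) :+ b) refl (seq x n) (seq x m)) ⟩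
    ℚ.∣ (seq x n - seq x m) + seq x m ∣
      ≤⟨ ℚ.∣p+q∣≤∣p∣+∣q∣ (seq x n - seq x m) (seq x m) ⟩
    ℚ.∣ seq x n - seq x m ∣ + ℚ.∣ seq x m ∣
      ≤⟨ ℚ.+-mono-≤ (f n m N≤n N≤m) xm≤ ⟩
    ½ * ε + ½ * ε
      ≡⟨ solve 1 (λ ε → con ½ :* ε :+ con ½ :* ε := ε) refl ε ⟩
    ε ∎
  where open ℚ.≤-Reasoning

1≉0 : ¬ (1ℝ ≈ℝ 0ℝ)
1≉0 1≈0 with 1≈0 ½ (ℚ.positive⁻¹ ½)
... | N , h = contradiction (h N ℕ.≤-refl) (<⇒≱ (p<p+ε ½ (ℚ.positive⁻¹ ½)))

-- Bisection

module Bisection (P : ℚ → Set) (P? : ∀ t → Dec (P t)) where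

  record Bracket : Set where
    constructor bracket
    field
      lo hi  : ℚ
      lo≤hi  : lo ℚ.≤ hi
      holds  : P lo
      fails  : ¬ P hi

  open Bracket

  mid : Bracket → ℚ
  mid b = ½ * (lo b + hi b)

  lo≤mid : ∀ b → lo b ℚ.≤ mid b
  lo≤mid b = ≤-by (ℚ.nonNegative⁻¹ ½ ⊗ ≤⇒0≤- (lo≤hi b))
    (solve 2 (λ l h → con ½ :* (l :+ h) := l :+ con ½ :* (h :- l)) refl (lo b) (hi b))

  mid≤hi : ∀ b → mid b ℚ.≤ hi b
  mid≤hi b = ≤-by (ℚ.nonNegative⁻¹ ½ ⊗ ≤⇒0≤- (lo≤hi b))
    (solve 2 (λ l h → h := con ½ :* (l :+ h) :+ con ½ :* (h :- l)) refl (lo b) (hi b))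

  halve : (b : Bracket) → ∃ λ b′ → lo b ℚ.≤ lo b′ × hi b′ ℚ.≤ hi b × hi b′ - lo b′ ≡ ½ * (hi b - lo b)
  halve b with P? (mid b)
  ... | yes p = bracket (mid b) (hi b) (mid≤hi b) p (fails b) , lo≤mid b , ℚ.≤-refl ,
    solve 2 (λ l h → h :- con ½ :* (l :+ h) := con ½ :* (h :- l)) refl (lo b) (hi b)
  ... | no ¬p = bracket (lo b) (mid b) (lo≤mid b) (holds b) ¬p , ℚ.≤-refl , mid≤hi b ,
    solve 2 (λ l h → con ½ :* (l :+ h) :- l := con ½ :* (h :- l)) refl (lo b) (hi b)

  next : Bracket → Bracket
  next b = proj₁ (halve b)

  -- Lower and upper endpoints alternate, so that P holds at the even indices
  -- and fails at the odd ones.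
  endpoints : Bracket → ℕ → ℚ
  endpoints b zero          = lo b
  endpoints b (suc zero)    = hi b
  endpoints b (suc (suc n)) = endpoints (next b) n

  lo≤endpoints : ∀ b n → lo b ℚ.≤ endpoints b n
  lo≤endpoints b zero          = ℚ.≤-refl
  lo≤endpoints b (suc zero)    = lo≤hi b
  lo≤endpoints b (suc (suc n)) = ℚ.≤-trans (proj₁ (proj₂ (halve b))) (lo≤endpoints (next b) n)

  endpoints≤hi : ∀ b n → endpoints b n ℚ.≤ hi b
  endpoints≤hi b zero          = lo≤hi b
  endpoints≤hi b (suc zero)    = ℚ.≤-refl
  endpoints≤hi b (suc (suc n)) = ℚ.≤-trans (endpoints≤hi (next b) n) (proj₁ (proj₂ (proj₂ (halve b))))

  -- Each halving uses up two indices of `endpoints`.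
  double : ℕ → ℕ
  double zero    = zero
  double (suc k) = suc (suc (double k))

  -- From index 2k on, all endpoints lie in the bracket obtained after k halvings, whose width is
  -- the initial one divided by 2ᵏ.
  endpoints-close : ∀ k b {ε} → hi b - lo b ℚ.≤ 2^ k * ε → ∀ m n → double k ≤ m → double k ≤ n →
                    ℚ.∣ endpoints b m - endpoints b n ∣ ℚ.≤ ε
  endpoints-close zero b {ε} w≤ε m n _ _ = ≤+⇒∣p-q∣≤ (endpoints b m) (endpoints b n) (close m n) (close n m)
    where
    close : ∀ i j → endpoints b i ℚ.≤ endpoints b j + ε
    close i j = ≤-by (≤⇒0≤- (endpoints≤hi b i) ⊕ ≤⇒0≤- (lo≤endpoints b j) ⊕ ≤⇒0≤- w≤ε)
      (solve 5 (λ i j l h ε → j :+ ε := i :+ (((h :- i) :+ (j :- l)) :+ (con 1ℚ :* ε :- (h :- l)))) refl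
        (endpoints b i) (endpoints b j) (lo b) (hi b) ε)
  endpoints-close (suc k) b {ε} w≤ε (suc (suc m)) (suc (suc n)) (s≤s (s≤s km)) (s≤s (s≤s kn)) =
    endpoints-close k (next b) {ε} (subst (ℚ._≤ 2^ k * ε) (sym (proj₂ (proj₂ (proj₂ (halve b)))))
      (≤-by (ℚ.nonNegative⁻¹ ½ ⊗ ≤⇒0≤- w≤ε)
        (solve 3 (λ w p ε → p :* ε := con ½ :* w :+ con ½ :* ((p :+ p) :* ε :- w)) refl
          (hi b - lo b) (2^ k) ε)))
      m n km kn

  threshold : Bracket → ℝ
  threshold b = mkℝ (endpoints b) λ ε 0<ε →
    let k , w≤ = archimedean (hi b - lo b) 0<ε in double k , endpoints-close k b w≤

  frequently-holds : ∀ b → Frequently (λ n → P (endpoints b n))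
  frequently-holds b zero    = zero , z≤n , holds b
  frequently-holds b (suc N) with frequently-holds (next b) N
  ... | n , N≤n , p = suc (suc n) , s≤s (ℕ.m≤n⇒m≤1+n N≤n) , p

  frequently-fails : ∀ b → Frequently (λ n → ¬ P (endpoints b n))
  frequently-fails b zero    = suc zero , z≤n , fails b
  frequently-fails b (suc N) with frequently-fails (next b) N
  ... | n , N≤n , ¬p = suc (suc n) , s≤s (ℕ.m≤n⇒m≤1+n N≤n) , ¬p

-- Kernel of a real matrix at the boundary of the semidefinite cone

-- The approximation at one index, so that exact algebra over ℚ applies index by index.
at : ∀ {n} → Matrix ℝ n → ℕ → Matrix ℚ n
at S k i j = seq (S i j) k

seq-Σℝ : ∀ {n} (f : Fin n → ℝ) k → seq (Σℝ f) k ≡ sum (λ i → seq (f i) k)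
seq-Σℝ {zero}  f k = refl
seq-Σℝ {suc n} f k = cong (seq (f zero) k +_) (seq-Σℝ (λ i → f (suc i)) k)

HasKernel : ∀ {n} → Matrix ℝ n → Set
HasKernel {n} S = ∃ λ (f : Fin n → ℝ) →
  ¬ (∀ v → f v ≈ℝ 0ℝ) × (∀ v → Σℝ (λ w → S v w *ℝ f w) ≈ℝ 0ℝ)

eventually-bounded : ∀ x → ∃ λ C → 0ℚ ℚ.< C × Eventually λ n → seq x n ℚ.≤ C
eventually-bounded x with cauchy x 1ℚ 0<1
... | N , f = ℚ.∣ seq x N ∣ + 1ℚ , ℚ.+-mono-≤-< (ℚ.0≤∣p∣ (seq x N)) 0<1 , N , λ n N≤n →
  ℚ.≤-trans (∣p-q∣≤ε⇒p≤q+ε (seq x n) (seq x N) (f n N N≤n ℕ.≤-refl))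
    (ℚ.+-monoˡ-≤ 1ℚ (p≤∣p∣ (seq x N)))

-- Limit version of `PSD⇒offDiagonal≡0`: as the pivot a tends to 0, a s ≤ 1 holds eventually for any
-- fixed s > 0, so s b² ≤ c ≤ C at infinitely many indices.
offDiagonal≈0 : ∀ {n} (S : Matrix ℝ (suc n)) → (∀ k → Symmetric (at S k)) →
  Frequently (λ k → PSD (at S k)) → S zero zero ≈ℝ 0ℝ → ∀ j → S zero (suc j) ≈ℝ 0ℝ
offDiagonal≈0 {n} S S-sym psd a≈0 j = frequently-small⇒≈ℝ0 (S zero (suc j)) small
  where
  C : ℚ
  C = proj₁ (eventually-bounded (S (suc j) (suc j)))
  0<C : 0ℚ ℚ.< C
  0<C = proj₁ (proj₂ (eventually-bounded (S (suc j) (suc j))))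
  c≤C : Eventually λ k → seq (S (suc j) (suc j)) k ℚ.≤ C
  c≤C = proj₂ (proj₂ (eventually-bounded (S (suc j) (suc j))))

  module _ (ε : ℚ) (0<ε : 0ℚ ℚ.< ε) (s : ℚ) (0<s : 0ℚ ℚ.< s) (s*ε²≡C : s * (ε * ε) ≡ C) where
    a*s≤1 : ∀ k → ℚ.∣ seq (S zero zero) k - 0ℚ ∣ ℚ.≤ 1/₀ s → seq (S zero zero) k * s ℚ.≤ 1ℚ
    a*s≤1 k h = subst (seq (S zero zero) k * s ℚ.≤_)
      (trans (ℚ.*-comm (1/₀ s) s) (0<p⇒p*1/₀p≡1 0<s))
      (ℚ.*-monoʳ-≤-nonNeg s {{ℚ.nonNegative (ℚ.<⇒≤ 0<s)}} {seq (S zero zero) k} {1/₀ s}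
        (subst (seq (S zero zero) k ℚ.≤_) (ℚ.+-identityˡ (1/₀ s))
          (∣p-q∣≤ε⇒p≤q+ε (seq (S zero zero) k) 0ℚ h)))

    b≤ε : ∀ k → PSD (at S k) →
          ℚ.∣ seq (S zero zero) k - 0ℚ ∣ ℚ.≤ 1/₀ s × seq (S (suc j) (suc j)) k ℚ.≤ C →
          ℚ.∣ seq (S zero (suc j)) k ∣ ℚ.≤ ε
    b≤ε k psd-k (a≤1/s , c≤C) = 0≤ε∧p*p≤ε*ε⇒∣p∣≤ε (seq (S zero (suc j)) k) (ℚ.<⇒≤ 0<ε)
      (ℚ.*-cancelˡ-≤-pos {seq (S zero (suc j)) k * seq (S zero (suc j)) k} {ε * ε} s {{ℚ.positive 0<s}}
        (subst (s * (seq (S zero (suc j)) k * seq (S zero (suc j)) k) ℚ.≤_) (sym s*ε²≡C)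
          (ℚ.≤-trans (PSD⇒s*b²≤c {S = at S k} (S-sym k) psd-k j s (ℚ.<⇒≤ 0<s) (a*s≤1 k a≤1/s)) c≤C)))

    frequently-b≤ε : Frequently λ k → ℚ.∣ seq (S zero (suc j)) k ∣ ℚ.≤ ε
    frequently-b≤ε = frequently∧eventually b≤ε psd
      (eventually-∧ {P = λ k → ℚ.∣ seq (S zero zero) k - 0ℚ ∣ ℚ.≤ 1/₀ s} {Q = λ k → seq (S (suc j) (suc j)) k ℚ.≤ C} (λ k → _,_) (a≈0 (1/₀ s) (0<p⇒0<1/₀p {s} 0<s)) c≤C)

  small : ∀ ε → 0ℚ ℚ.< ε → Frequently λ k → ℚ.∣ seq (S zero (suc j)) k ∣ ℚ.≤ ε
  -- The choice s = C / ε² turns s b² ≤ C into b² ≤ ε².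
  small ε 0<ε = frequently-b≤ε ε 0<ε (C * 1/₀ (ε * ε))
    (0<p*q {C} {1/₀ (ε * ε)} 0<C (0<p⇒0<1/₀p {ε * ε} (0<p*q {ε} {ε} 0<ε 0<ε)))
    (p*1/₀q*q≡p C (ε * ε) (0<p*q {ε} {ε} 0<ε 0<ε))

-- Written so that its approximation at k is `schur (at S k)` by definition.
schurℝ : ∀ {n} (S : Matrix ℝ (suc n)) → 0ℝ <ℝ S zero zero → Matrix ℝ n
schurℝ S 0<a i j = S (suc i) (suc j) -ℝ S (suc i) zero *ℝ S zero (suc j) *ℝ inverse (S zero zero) 0<a

-- Induction on the size. If the pivot were positive, both alternating properties would pass to the
-- Schur complement, and a kernel vector there would lift back. So the pivot is zero and
-- semidefiniteness kills its column. In size 0 every form is semidefinite.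
singular : ∀ {n} (S : Matrix ℝ n) → (∀ k → Symmetric (at S k)) →
  Frequently (λ k → PSD (at S k)) → Frequently (λ k → ¬ PSD (at S k)) → ¬ ¬ HasKernel S
singular {zero}  S S-sym psd ¬psd _ with ¬psd 0
... | _ , _ , ¬psd-k = ¬psd-k λ _ → ℚ.≤-refl
singular {suc n} S S-sym psd ¬psd ¬kernel = a≯0 a>0
  where
  a = S zero zero

  a≯0 : ¬ (0ℝ <ℝ a)
  a≯0 0<a@(δ , 0<δ , δ≤a) = singular (schurℝ S 0<a) (λ k → schur-symmetric {S = at S k} (S-sym k))
    (frequently∧eventually (λ k psd-k 0<ak → PSD⇒PSD-schur {S = at S k} (S-sym k) 0<ak psd-k) psd 0<a-ev)
    (frequently∧eventually (λ k ¬psd-k 0<ak psd′ → ¬psd-k (PSD-schur⇒PSD {S = at S k} (S-sym k) 0<ak psd′))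
      ¬psd 0<a-ev)
    λ (g , g≉0 , Sg≈0) → ¬kernel (lift g , (λ f≈0 → g≉0 λ i → f≈0 (suc i)) , rows g Sg≈0)
    where
    0<a-ev : Eventually λ k → 0ℚ ℚ.< seq a k
    0<a-ev = proj₁ δ≤a , λ k h → ℚ.<-≤-trans 0<δ
      (subst (ℚ._≤ seq a k) (ℚ.+-identityˡ δ) (proj₂ δ≤a k h))
    lift : (Fin n → ℝ) → Fin (suc n) → ℝ
    lift g = -ℝ (inverse a 0<a *ℝ Σℝ λ j → S zero (suc j) *ℝ g j) ∷ᶠ g
    seq-lift : ∀ g k w → seq (lift g w) k ≡ schurLift (at S k) (λ j → seq (g j) k) w
    seq-lift g k zero    = cong (λ s → - (1/₀ seq a k * s)) (seq-Σℝ (λ j → S zero (suc j) *ℝ g j) k)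
    seq-lift g k (suc j) = refl
    seq-row : ∀ g k v → seq (Σℝ λ w → S v w *ℝ lift g w) k ≡
                        apply (at S k) (schurLift (at S k) (λ j → seq (g j) k)) v
    seq-row g k v = trans (seq-Σℝ (λ w → S v w *ℝ lift g w) k)
      (sum-cong-≗ λ w → cong (seq (S v w) k *_) (seq-lift g k w))
    rows : ∀ g → (∀ i → Σℝ (λ j → schurℝ S 0<a i j *ℝ g j) ≈ℝ 0ℝ) →
           ∀ v → Σℝ (λ w → S v w *ℝ lift g w) ≈ℝ 0ℝ
    -- The row vanishes exactly once the approximate pivot is positive.
    rows g Sg≈0 zero = ≈ℝ0-resp (Σℝ λ w → S zero w *ℝ lift g w) 0ℝ
      (proj₁ 0<a-ev , λ k h → trans (seq-row g k zero)
        (apply-schurLift-zero (at S k) (proj₂ 0<a-ev k h) (λ j → seq (g j) k)))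
      (λ ε 0<ε → 0 , λ _ _ → ℚ.<⇒≤ 0<ε)
    rows g Sg≈0 (suc i) = ≈ℝ0-resp (Σℝ λ w → S (suc i) w *ℝ lift g w) (Σℝ λ j → schurℝ S 0<a i j *ℝ g j)
      (0 , λ k _ → trans (seq-row g k (suc i)) (trans (apply-schurLift-suc (at S k) (λ j → seq (g j) k) i)
        (sym (seq-Σℝ (λ j → schurℝ S 0<a i j *ℝ g j) k))))
      (Sg≈0 i)

  a≈0 : a ≈ℝ 0ℝ
  -- Not being positive gives a ≤ 0; the nonnegative diagonals of the semidefinite approximations
  -- give 0 ≤ a.
  a≈0 = ≤ℝ-antisym {a} {0ℝ} (≮ℝ⇒≥ℝ a 0ℝ a≯0) (frequently-≤⇒≤ℝ 0ℝ a
    λ N → let k , N≤k , psd-k = psd N in k , N≤k , PSD⇒0≤diagonal {S = at S k} psd-k zero)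

  column₀≈0 : ∀ v → S v zero ≈ℝ 0ℝ
  column₀≈0 zero    = a≈0
  column₀≈0 (suc j) = ≈ℝ0-resp (S (suc j) zero) (S zero (suc j)) (0 , λ k _ → S-sym k (suc j) zero)
    (offDiagonal≈0 S S-sym psd a≈0 j)

  -- The column being zero, the first basis vector is a kernel vector. This contradicts `¬kernel`,
  -- and from the contradiction follows the positivity that `a≯0` refutes.
  a>0 : 0ℝ <ℝ a
  a>0 = contradiction
    ((λ w → fromℚ (identity zero w)) , (λ e₀≈0 → 1≉0 (e₀≈0 zero)) , λ v →
      ≈ℝ0-resp (Σℝ λ w → S v w *ℝ fromℚ (identity zero w)) (S v zero)
        (0 , λ k _ → trans (seq-Σℝ (λ w → S v w *ℝ fromℚ (identity zero w)) k) (apply-identity (at S k) v zero))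
        (column₀≈0 v))
    ¬kernel

-- Counting with rational indicators

𝟙 : Bool → ℚ
𝟙 b = if b then 1ℚ else 0ℚ

𝟙-∧ : ∀ a b → 𝟙 (a ∧ b) ≡ 𝟙 a * 𝟙 b
𝟙-∧ true  b = sym (ℚ.*-identityˡ (𝟙 b))
𝟙-∧ false b = sym (ℚ.*-zeroˡ (𝟙 b))

ι-length-filter-∷ : ∀ {A : Set} {P : A → Set} (P? : Decidable P) x xs →
  ι (length (filter P? (x ∷ xs))) ≡ 𝟙 (does (P? x)) + ι (length (filter P? xs))
ι-length-filter-∷ P? x xs with does (P? x)
... | true  = ι-+ 1 (length (filter P? xs))
... | false = sym (ℚ.+-identityˡ (ι (length (filter P? xs))))

ι-sum-filter-tabulate : ∀ {A : Set} {P : A → Set} (P? : Decidable P) (f : A → ℕ) {n} (g : Fin n → A) →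
  ι (sumℕ (List.map f (filter P? (List.tabulate g)))) ≡ sum (λ i → 𝟙 (does (P? (g i))) * ι (f (g i)))
ι-sum-filter-tabulate P? f {zero}  g = refl
ι-sum-filter-tabulate P? f {suc n} g with does (P? (g zero)) | ι-sum-filter-tabulate P? f (g ∘ suc)
... | true  | ih = trans (ι-+ (f (g zero)) _) (cong₂ _+_ (sym (ℚ.*-identityˡ (ι (f (g zero))))) ih)
... | false | ih = trans (sym (ℚ.+-identityˡ _)) (cong₂ _+_ (sym (ℚ.*-zeroˡ (ι (f (g zero))))) ih)

sum-ones : ∀ n → sum {n} (λ _ → 1ℚ) ≡ ι n
sum-ones zero    = refl
sum-ones (suc n) = trans (cong (1ℚ +_) (sum-ones n)) (sym (ι-+ 1 n))

sum-∈? : ∀ {n} (e : Subset n) → sum (λ v → 𝟙 (does (v ∈? e))) ≡ ι ∣ e ∣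
sum-∈? Vec.[]              = refl
sum-∈? (inside  Vec.∷ e)   = trans (cong (1ℚ +_) (sum-∈? e)) (sym (ι-+ 1 ∣ e ∣))
sum-∈? (outside Vec.∷ e)   = trans (ℚ.+-identityˡ _) (sum-∈? e)

-- The pencil of a hypergraph

module _ {n : ℕ} where

  incidence : Subset n → Fin n → ℚ
  incidence e v = 𝟙 (does (v ∈? e))

  degs : List (Subset n) → Fin n → ℚ
  degs es v = ι (length (filter (v ∈?_) es))

  -- Unlike in `adjacency`, the diagonal is kept, so this is the sum of the rank-one matrices 1ₑ 1ₑᵀ
  -- over the listed edges. An arbitrary list is taken to allow induction.
  codegs : List (Subset n) → Matrix ℚ n
  codegs es v w = ι (length (filter (λ e → (v ∈? e) ×-dec (w ∈? e)) es))

  codegs-∷ : ∀ e es v w → codegs (e ∷ es) v w ≡ incidence e v * incidence e w + codegs es v w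
  codegs-∷ e es v w = trans (ι-length-filter-∷ (λ e → (v ∈? e) ×-dec (w ∈? e)) e es)
    (cong (_+ codegs es v w) (𝟙-∧ (does (v ∈? e)) (does (w ∈? e))))

  codegs-symmetric : ∀ es → Symmetric (codegs es)
  codegs-symmetric []       v w = refl
  codegs-symmetric (e ∷ es) v w = begin
    codegs (e ∷ es) v w                               ≡⟨ codegs-∷ e es v w ⟩
    incidence e v * incidence e w + codegs es v w     ≡⟨ cong₂ _+_ (ℚ.*-comm (incidence e v) (incidence e w)) (codegs-symmetric es v w) ⟩
    incidence e w * incidence e v + codegs es w v     ≡⟨ codegs-∷ e es w v ⟨
    codegs (e ∷ es) w v                               ∎
    where open ≡-Reasoning

  codegs-diagonal : ∀ es v → codegs es v v ≡ degs es v
  codegs-diagonal []       v = refl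
  codegs-diagonal (e ∷ es) v = begin
    codegs (e ∷ es) v v                            ≡⟨ codegs-∷ e es v v ⟩
    incidence e v * incidence e v + codegs es v v  ≡⟨ cong₂ _+_ (idem (does (v ∈? e))) (codegs-diagonal es v) ⟩
    incidence e v + degs es v                      ≡⟨ ι-length-filter-∷ (v ∈?_) e es ⟨
    degs (e ∷ es) v                                ∎
    where
    open ≡-Reasoning
    idem : ∀ b → 𝟙 b * 𝟙 b ≡ 𝟙 b
    idem true  = refl
    idem false = refl

  -- Every edge through v contributes each of its c vertices once to row v.
  codegs-rowSum : ∀ {c} es → All (λ e → ∣ e ∣ ≡ c) es → ∀ v → sum (codegs es v) ≡ ι c * degs es v
  codegs-rowSum {c} []       []           v = trans (sum-zero {f = codegs [] v} λ _ → refl) (sym (ℚ.*-zeroʳ (ι c)))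
  codegs-rowSum {c} (e ∷ es) (|e|≡c ∷ es-c) v = begin
    sum (codegs (e ∷ es) v)
      ≡⟨ sum-cong-≗ (codegs-∷ e es v) ⟩
    sum (λ w → incidence e v * incidence e w + codegs es v w)
      ≡⟨ ∑-distrib-+ (λ w → incidence e v * incidence e w) (codegs es v) ⟩
    sum (λ w → incidence e v * incidence e w) + sum (codegs es v)
      ≡⟨ cong₂ _+_ (trans (sum-scale (incidence e v) (incidence e))
           (cong (incidence e v *_) (trans (sum-∈? e) (cong ι |e|≡c)))) (codegs-rowSum es es-c v) ⟩
    incidence e v * ι c + ι c * degs es v
      ≡⟨ solve 3 (λ i c d → i :* c :+ c :* d := c :* (i :+ d)) refl (incidence e v) (ι c) (degs es v) ⟩
    ι c * (incidence e v + degs es v)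
      ≡⟨ cong (ι c *_) (ι-length-filter-∷ (v ∈?_) e es) ⟨
    ι c * degs (e ∷ es) v ∎
    where open ≡-Reasoning

  quad-matrix-cong : ∀ {S T : Matrix ℚ n} → (∀ i j → S i j ≡ T i j) → ∀ x → quad S x ≡ quad T x
  quad-matrix-cong S≗T x = sum-cong-≗ λ i → cong (x i *_) (sum-cong-≗ λ j → cong (_* x j) (S≗T i j))

  quad-rankOne-+ : ∀ (u : Fin n → ℚ) (G : Matrix ℚ n) x →
    quad (λ v w → u v * u w + G v w) x ≡ sum (λ v → u v * x v) * sum (λ v → u v * x v) + quad G x
  quad-rankOne-+ u G x = begin
    sum (λ v → x v * sum (λ w → (u v * u w + G v w) * x w))
      ≡⟨ sum-cong-≗ (λ v → cong (x v *_) (trans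
           (sum-cong-≗ λ w → solve 4 (λ a b g x → (a :* b :+ g) :* x := a :* (b :* x) :+ g :* x) refl
             (u v) (u w) (G v w) (x w))
           (trans (∑-distrib-+ (λ w → u v * (u w * x w)) (λ w → G v w * x w))
             (cong (_+ apply G x v) (sum-scale (u v) (λ w → u w * x w)))))) ⟩
    sum (λ v → x v * (u v * s + apply G x v))
      ≡⟨ sum-cong-≗ (λ v → solve 4 (λ x u s g → x :* (u :* s :+ g) := s :* (u :* x) :+ x :* g) refl
           (x v) (u v) s (apply G x v)) ⟩
    sum (λ v → s * (u v * x v) + x v * apply G x v)
      ≡⟨ ∑-distrib-+ (λ v → s * (u v * x v)) (λ v → x v * apply G x v) ⟩
    sum (λ v → s * (u v * x v)) + quad G x
      ≡⟨ cong (_+ quad G x) (sum-scale s (λ v → u v * x v)) ⟩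
    s * s + quad G x ∎
    where
    open ≡-Reasoning
    s = sum (λ v → u v * x v)

  -- The form is the sum over the edges of the squared sums of x over each edge, built up one
  -- rank-one summand at a time.
  codegs-PSD : ∀ es → PSD (codegs es)
  codegs-PSD []       x = sum-nonneg λ v → ℚ.≤-reflexive (sym
    (trans (cong (x v *_) (sum-zero λ w → ℚ.*-zeroˡ (x w))) (ℚ.*-zeroʳ (x v))))
  codegs-PSD (e ∷ es) x = subst (0ℚ ℚ.≤_)
    (sym (trans (quad-matrix-cong (codegs-∷ e es) x) (quad-rankOne-+ (incidence e) (codegs es) x)))
    (0≤p*p (sum λ v → incidence e v * x v) ⊕ codegs-PSD es x)

ι*[z/d]≡z/1 : ∀ z d .{{_ : ℕ.NonZero d}} → ι d * (z ℚ./ d) ≡ z ℚ./ 1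
ι*[z/d]≡z/1 z (suc d) = ℚ.toℚᵘ-injective (begin
  ℚ.toℚᵘ (ι (suc d) * (z ℚ./ suc d))
    ≈⟨ ℚ.toℚᵘ-homo-* (ι (suc d)) (z ℚ./ suc d) ⟩
  ℚ.toℚᵘ (ι (suc d)) ℚᵘ.* ℚ.toℚᵘ (z ℚ./ suc d)
    ≈⟨ ℚᵘ.*-cong (toℚᵘ-ι (suc d)) (ℚ.toℚᵘ-fromℚᵘ (ℚᵘ.mkℚᵘ z d)) ⟩
  ℚᵘ.mkℚᵘ (ℤ.+ suc d) 0 ℚᵘ.* ℚᵘ.mkℚᵘ z d
    ≈⟨ ℚᵘ.*≡* (trans (ℤ.*-identityʳ (ℤ.+ suc d ℤ.* z)) (trans (ℤ.*-comm (ℤ.+ suc d) z)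
         (cong (λ m → z ℤ.* ℤ.+ m) (sym (ℕ.+-identityʳ (suc d)))))) ⟩
  ℚᵘ.mkℚᵘ z 0
    ≈⟨ ℚ.toℚᵘ-fromℚᵘ (ℚᵘ.mkℚᵘ z 0) ⟨
  ℚ.toℚᵘ (z ℚ./ 1) ∎)
  where open ℚᵘ.≃-Reasoning

-‿/1 : ∀ n → (ℤ.- (ℤ.+ n)) ℚ./ 1 ≡ - ι n
-‿/1 zero    = refl
-‿/1 (suc n) = refl

module _ (Γ : Hypergraph) where

  D : Vertex Γ → ℚ
  D v = ι (deg Γ v)

  gram : Matrix ℚ (order Γ)
  gram = codegs (edges Γ)

  ∣A∣ : Matrix ℚ (order Γ)
  ∣A∣ v w = ι ℤ.∣ adjacency Γ v w ∣

  volume : ℚ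
  volume = sum D

  -- Off the diagonal the adjacency is minus the codegree, so absolute values restore it; on the
  -- diagonal the codegree is the degree.
  gram≡D+∣A∣ : ∀ v w → gram v w ≡ identity v w * D v + ∣A∣ v w
  gram≡D+∣A∣ v w with v Fin.≟ w
  ... | yes refl = trans (codegs-diagonal (edges Γ) v)
    (solve 1 (λ d → d := con 1ℚ :* d :+ con 0ℚ) refl (D v))
  ... | no  _    = trans (cong ι (sym (ℤ.∣-i∣≡∣i∣ (ℤ.+ codeg Γ v w))))
    (solve 2 (λ d a → a := con 0ℚ :* d :+ a) refl (D v) (ι ℤ.∣ ℤ.- (ℤ.+ codeg Γ v w) ∣))

  -- Scaling row v by its degree clears the denominators and makes the Laplacian symmetric.
  D*laplacian≡gram : ∀ deg≥1 v w → D v * laplacian Γ deg≥1 v w ≡ gram v w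
  D*laplacian≡gram deg≥1 v w with v Fin.≟ w
  ... | yes refl = begin
    D v * (1ℚ - ℤ.+ 0 ℚ./ deg Γ v)  ≡⟨ cong (λ p → D v * (1ℚ - p)) (ℚ.0/n≡0 (deg Γ v)) ⟩
    D v * (1ℚ - 0ℚ)                 ≡⟨ ℚ.*-identityʳ (D v) ⟩
    D v                             ≡⟨ codegs-diagonal (edges Γ) v ⟨
    gram v v                        ∎
    where
    open ≡-Reasoning
    instance _ = ℕ.>-nonZero (deg≥1 v)
  ... | no  _    = begin
    D v * (0ℚ - (ℤ.- (ℤ.+ codeg Γ v w)) ℚ./ deg Γ v)
      ≡⟨ solve 2 (λ d p → d :* (con 0ℚ :- p) := :- (d :* p)) refl (D v) ((ℤ.- (ℤ.+ codeg Γ v w)) ℚ./ deg Γ v) ⟩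
    - (D v * ((ℤ.- (ℤ.+ codeg Γ v w)) ℚ./ deg Γ v))
      ≡⟨ cong -_ (trans (ι*[z/d]≡z/1 (ℤ.- (ℤ.+ codeg Γ v w)) (deg Γ v)) (-‿/1 (codeg Γ v w))) ⟩
    - - gram v w
      ≡⟨ solve 1 (λ g → :- :- g := g) refl (gram v w) ⟩
    gram v w ∎
    where
    open ≡-Reasoning
    instance _ = ℕ.>-nonZero (deg≥1 v)

  -- For positive degrees it is semidefinite exactly when t bounds all Rayleigh quotients xᵀBx /
  -- xᵀDx from below.
  pencil : ℚ → Matrix ℚ (order Γ)
  pencil t v w = gram v w - t * (identity v w * D v)

  pencil-symmetric : ∀ t → Symmetric (pencil t)
  pencil-symmetric t v w = cong₂ (λ g d → g - t * d) (codegs-symmetric (edges Γ) v w) (diagonal (v Fin.≟ w))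
    where
    diagonal : Dec (v ≡ w) → identity v w * D v ≡ identity w v * D w
    diagonal (yes refl) = refl
    diagonal (no v≢w) = begin
      identity v w * D v ≡⟨ cong (_* D v) (identity-≢ v≢w) ⟩
      0ℚ * D v           ≡⟨ trans (ℚ.*-zeroˡ (D v)) (sym (ℚ.*-zeroˡ (D w))) ⟩
      0ℚ * D w           ≡⟨ cong (_* D w) (identity-≢ (v≢w ∘ sym)) ⟨
      identity w v * D w ∎
      where open ≡-Reasoning

  pencil-0-PSD : PSD (pencil 0ℚ)
  pencil-0-PSD x = subst (0ℚ ℚ.≤_)
    (quad-matrix-cong (λ v w → solve 2 (λ g d → g := g :- con 0ℚ :* d) refl (gram v w) (identity v w * D v)) x)
    (codegs-PSD (edges Γ) x)

  -- The diagonal entry at v is d - 2d = - d.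
  pencil-2-¬PSD : ∀ v → 0ℚ ℚ.< D v → ¬ PSD (pencil (1ℚ + 1ℚ))
  pencil-2-¬PSD v 0<d psd = <⇒≱ 0<d (≤-by (PSD⇒0≤diagonal {S = pencil (1ℚ + 1ℚ)} psd v)
    (trans (solve 1 (λ d → con 0ℚ := d :+ (d :- (con 1ℚ :+ con 1ℚ) :* (con 1ℚ :* d))) refl (D v))
      (cong₂ (λ g i → D v + (g - (1ℚ + 1ℚ) * (i * D v)))
        (sym (codegs-diagonal (edges Γ) v)) (sym (identity-refl v)))))

  pencilℝ : ℝ → Matrix ℝ (order Γ)
  pencilℝ ν v w = fromℚ (gram v w) -ℝ ν *ℝ fromℚ (identity v w * D v)

  apply-pencil : ∀ deg≥1 t x v →
    apply (pencil t) x v ≡ D v * (apply (laplacian Γ deg≥1) x v - t * x v)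
  apply-pencil deg≥1 t x v = begin
    sum (λ w → (gram v w - t * (identity v w * D v)) * x w)
      ≡⟨ sum-cong-≗ (λ w → trans (cong (λ g → (g - t * (identity v w * D v)) * x w)
             (sym (D*laplacian≡gram deg≥1 v w)))
           (solve 5 (λ d l t i x → (d :* l :- t :* (i :* d)) :* x := d :* (l :* x) :- (d :* t) :* (i :* x)) refl
             (D v) (laplacian Γ deg≥1 v w) t (identity v w) (x w))) ⟩
    sum (λ w → D v * (laplacian Γ deg≥1 v w * x w) - (D v * t) * (identity v w * x w))
      ≡⟨ sum-affine (λ w → D v * (laplacian Γ deg≥1 v w * x w)) (λ w → identity v w * x w) (D v * t) ⟩
    sum (λ w → D v * (laplacian Γ deg≥1 v w * x w)) - (D v * t) * sum (λ w → identity v w * x w)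
      ≡⟨ cong₂ (λ p q → p - (D v * t) * q) (sum-scale (D v) (λ w → laplacian Γ deg≥1 v w * x w)) (sum-identity v x) ⟩
    D v * apply (laplacian Γ deg≥1) x v - (D v * t) * x v
      ≡⟨ solve 4 (λ d l t x → d :* l :- (d :* t) :* x := d :* (l :- t :* x)) refl
           (D v) (apply (laplacian Γ deg≥1) x v) t (x v) ⟩
    D v * (apply (laplacian Γ deg≥1) x v - t * x v) ∎
    where open ≡-Reasoning

  1≤D : NoIsolatedVertices Γ → ∀ v → 1ℚ ℚ.≤ D v
  1≤D deg≥1 v = ι-mono (deg≥1 v)

  -- Row v of the pencil is deg v ≥ 1 times the residual of the eigenvalue equation, so the residual
  -- is small with the same ε.
  kernel⇒eigenvalue : ∀ deg≥1 ν → HasKernel (pencilℝ ν) → IsEigenvalue (laplacian Γ deg≥1) ν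
  kernel⇒eigenvalue deg≥1 ν (f , f≉0 , Sf≈0) = f , f≉0 , λ v ε 0<ε →
    let N , h = Sf≈0 v ε 0<ε in N , λ k N≤k → small v k (h k N≤k)
    where
    small : ∀ v k {ε} → ℚ.∣ seq (Σℝ λ w → pencilℝ ν v w *ℝ f w) k - 0ℚ ∣ ℚ.≤ ε →
            ℚ.∣ seq ((laplacian Γ deg≥1 · f) v) k - seq ν k * seq (f v) k ∣ ℚ.≤ ε
    small v k {ε} h = ℚ.≤-trans
      (≤-by (≤⇒0≤- (1≤D deg≥1 v) ⊗ ℚ.0≤∣p∣ y)
        (solve 2 (λ d y → d :* y := y :+ (d :- con 1ℚ) :* y) refl (D v) ℚ.∣ y ∣))
      (subst (ℚ._≤ ε) eq h)
      where
      fk : Vertex Γ → ℚ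
      fk w = seq (f w) k
      y = seq ((laplacian Γ deg≥1 · f) v) k - seq ν k * seq (f v) k
      eq : ℚ.∣ seq (Σℝ λ w → pencilℝ ν v w *ℝ f w) k - 0ℚ ∣ ≡ D v * ℚ.∣ y ∣
      eq = begin
        ℚ.∣ seq (Σℝ λ w → pencilℝ ν v w *ℝ f w) k - 0ℚ ∣
          ≡⟨ cong ℚ.∣_∣ (trans (ℚ.+-identityʳ _) (seq-Σℝ (λ w → pencilℝ ν v w *ℝ f w) k)) ⟩
        ℚ.∣ apply (pencil (seq ν k)) fk v ∣
          ≡⟨ cong ℚ.∣_∣ (apply-pencil deg≥1 (seq ν k) fk v) ⟩
        ℚ.∣ D v * (apply (laplacian Γ deg≥1) fk v - seq ν k * fk v) ∣
          ≡⟨ cong (λ l → ℚ.∣ D v * (l - seq ν k * fk v) ∣)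
               (seq-Σℝ (λ w → fromℚ (laplacian Γ deg≥1 v w) *ℝ f w) k) ⟨
        ℚ.∣ D v * y ∣
          ≡⟨ ℚ.∣p*q∣≡∣p∣*∣q∣ (D v) y ⟩
        ℚ.∣ D v ∣ * ℚ.∣ y ∣
          ≡⟨ cong (_* ℚ.∣ y ∣) (ℚ.0≤p⇒∣p∣≡p (0≤ι (deg Γ v))) ⟩
        D v * ℚ.∣ y ∣ ∎
        where open ≡-Reasoning

≤ℝ-*-nonneg : ∀ x y a → 0ℚ ℚ.≤ a → x ≤ℝ y → x *ℝ fromℚ a ≤ℝ y *ℝ fromℚ a
≤ℝ-*-nonneg x y a 0≤a x≤y ε 0<ε = proj₁ ev , λ n h → ≤-by
  (0≤a ⊗ ≤⇒0≤- (proj₂ ev n h) ⊕ ℚ.<⇒≤ 0<δ)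
  (trans (cong (seq y n * a +_) (sym δ*[a+1]≡ε))
    (solve 4 (λ x y a δ → y :* a :+ δ :* (a :+ con 1ℚ) := x :* a :+ (a :* ((y :+ δ) :- x) :+ δ)) refl
      (seq x n) (seq y n) a δ))
  where
  0<a+1 : 0ℚ ℚ.< a + 1ℚ
  0<a+1 = ℚ.+-mono-≤-< 0≤a 0<1
  -- Dividing by a + 1 rather than a keeps the divisor positive when a = 0.
  δ = ε * 1/₀ (a + 1ℚ)
  δ*[a+1]≡ε : δ * (a + 1ℚ) ≡ ε
  δ*[a+1]≡ε = p*1/₀q*q≡p ε (a + 1ℚ) 0<a+1
  0<δ : 0ℚ ℚ.< δ
  0<δ = 0<p*q {ε} {1/₀ (a + 1ℚ)} 0<ε (0<p⇒0<1/₀p {a + 1ℚ} 0<a+1)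
  ev = x≤y δ 0<δ

eventually-∀ : ∀ {n} {P : Fin n → ℕ → Set} → (∀ i → Eventually (P i)) → Eventually (λ k → ∀ i → P i k)
eventually-∀ {zero}  ev = 0 , λ _ _ ()
eventually-∀ {suc n} {P} ev = eventually-∧ {P zero} {λ k → ∀ i → P (suc i) k}
  (λ k p ps → λ { zero → p ; (suc i) → ps i }) (ev zero) (eventually-∀ (λ i → ev (suc i)))

-- Rayleigh bounds for the smallest eigenvalue

module _ (Γ : Hypergraph) (deg≥1 : NoIsolatedVertices Γ) (v₀ : Vertex Γ) where

  open Bisection (λ t → PSD (pencil Γ t)) (λ t → PSD? {S = pencil Γ t} (pencil-symmetric Γ t))

  start : Bracket
  start = bracket 0ℚ (1ℚ + 1ℚ) (0≤1 ⊕ 0≤1) (pencil-0-PSD Γ)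
    (pencil-2-¬PSD Γ v₀ (ℚ.<-≤-trans 0<1 (1≤D Γ deg≥1 v₀)))

  ν : ℝ
  ν = threshold start

  ν-eigenvalue : ¬ ¬ IsEigenvalue (laplacian Γ deg≥1) ν
  ν-eigenvalue ¬eig = singular (pencilℝ Γ ν) (λ k → pencil-symmetric Γ (seq ν k))
    (frequently-holds start) (frequently-fails start) λ ker → ¬eig (kernel⇒eigenvalue Γ deg≥1 ν ker)

  -- A linear inequality valid at every semidefinite rational t passes to the limit ν, since such t
  -- occur infinitely often in its sequence; and λ₁ ≤ ν.
  rayleigh : ∀ {λ₁} → IsSmallestEigenvalue (laplacian Γ deg≥1) λ₁ → ∀ a b → 0ℚ ℚ.≤ a →
    (∀ t → PSD (pencil Γ t) → t * a ℚ.≤ b) → λ₁ *ℝ fromℚ a ≤ℝ fromℚ b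
  rayleigh {λ₁} smallest a b 0≤a t*a≤b = ≤ℝ-trans {λ₁ *ℝ fromℚ a} {ν *ℝ fromℚ a} {fromℚ b}
    -- That ν is an eigenvalue is known only up to double negation, which stability of `≤ℝ` removes.
    (≤ℝ-*-nonneg λ₁ ν a 0≤a (≤ℝ-stable λ₁ ν λ λ₁≰ν → ν-eigenvalue λ eig → λ₁≰ν (proj₂ smallest ν eig)))
    (frequently-≤⇒≤ℝ (ν *ℝ fromℚ a) (fromℚ b) λ N →
      let n , N≤n , psd = frequently-holds start N in n , N≤n , t*a≤b (seq ν n) psd)

-- The test vectors k 1_{Vᵢ} - 1

module _ {k : ℕ} where

  -- `test a i` is the entry of k 1_{Vᵢ} - 1 at a vertex of colour a.
  test : Fin k → Fin k → ℚ
  test a i = identity a i * ι k - 1ℚ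

  sum-test : ∀ a → sum (test a) ≡ 0ℚ
  sum-test a = begin
    sum (λ i → identity a i * ι k - 1ℚ * 1ℚ)             ≡⟨ sum-affine (λ i → identity a i * ι k) (λ _ → 1ℚ) 1ℚ ⟩
    sum (λ i → identity a i * ι k) - 1ℚ * sum {k} (λ _ → 1ℚ) ≡⟨ cong₂ (λ p q → p - 1ℚ * q) (sum-identity a (λ _ → ι k)) (sum-ones k) ⟩
    ι k - 1ℚ * ι k                                       ≡⟨ solve 1 (λ k → k :- con 1ℚ :* k := con 0ℚ) refl (ι k) ⟩
    0ℚ                                                   ∎
    where open ≡-Reasoning

  -- As `test b` sums to zero, only the term i = a survives, giving k `test b a`.
  sum-test*test : ∀ a b → sum (λ i → test a i * test b i) ≡ ι k * (identity b a * ι k - 1ℚ)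
  sum-test*test a b = begin
    sum (λ i → test a i * test b i)
      ≡⟨ sum-cong-≗ (λ i → solve 3 (λ δ k t → (δ :* k :- con 1ℚ) :* t := δ :* (k :* t) :- con 1ℚ :* t) refl
           (identity a i) (ι k) (test b i)) ⟩
    sum (λ i → identity a i * (ι k * test b i) - 1ℚ * test b i)
      ≡⟨ sum-affine (λ i → identity a i * (ι k * test b i)) (test b) 1ℚ ⟩
    sum (λ i → identity a i * (ι k * test b i)) - 1ℚ * sum (test b)
      ≡⟨ cong₂ (λ p q → p - 1ℚ * q) (sum-identity a (λ i → ι k * test b i)) (sum-test b) ⟩
    ι k * test b a - 1ℚ * 0ℚ
      ≡⟨ ℚ.+-identityʳ (ι k * test b a) ⟩
    ι k * test b a ∎
    where open ≡-Reasoning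

  -- Interchanging the sums leaves only the inner products of `sum-test*test`, which see just
  -- whether v and w share a class.
  sum-quad-test : ∀ {n} (S : Matrix ℚ n) (κ : Fin n → Fin k) →
    sum (λ i → quad S (λ v → test (κ v) i)) ≡
    sum (λ v → sum (λ w → S v w * (ι k * (identity (κ w) (κ v) * ι k - 1ℚ))))
  sum-quad-test S κ = trans (∑-comm (λ i v → test (κ v) i * apply S (λ v → test (κ v) i) v))
    (sum-cong-≗ λ v → begin
      sum (λ i → test (κ v) i * sum (λ w → S v w * test (κ w) i))
        ≡⟨ sum-cong-≗ (λ i → sym (sum-scale (test (κ v) i) (λ w → S v w * test (κ w) i))) ⟩
      sum (λ i → sum (λ w → test (κ v) i * (S v w * test (κ w) i)))
        ≡⟨ ∑-comm (λ i w → test (κ v) i * (S v w * test (κ w) i)) ⟩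
      sum (λ w → sum (λ i → test (κ v) i * (S v w * test (κ w) i)))
        ≡⟨ sum-cong-≗ (λ w → trans
             (sum-cong-≗ λ i → solve 3 (λ a s b → a :* (s :* b) := s :* (a :* b)) refl
               (test (κ v) i) (S v w) (test (κ w) i))
             (trans (sum-scale (S v w) (λ i → test (κ v) i * test (κ w) i))
               (cong (S v w *_) (sum-test*test (κ v) (κ w))))) ⟩
      sum (λ w → S v w * (ι k * (identity (κ w) (κ v) * ι k - 1ℚ))) ∎)
    where open ≡-Reasoning

-- Class sums and the averaged Hoffman inequality.

module _ (Γ : Hypergraph) {k : ℕ} (κ : Coloring Γ k) where

  innerDegree : Vertex Γ → ℚ
  innerDegree v = sum λ w → identity (κ w) (κ v) * ∣A∣ Γ v w

  ι-innerDegree : ∀ i v → κ v ≡ i →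
    ι (sumℕ (List.map (λ w → ℤ.∣ adjacency Γ v w ∣) (colorClass Γ κ i))) ≡ innerDegree v
  ι-innerDegree i v refl =
    ι-sum-filter-tabulate (λ w → κ w Fin.≟ κ v) (λ w → ℤ.∣ adjacency Γ v w ∣) {order Γ} id

  -- Within the class of v the diagonal entry contributes (1 - t) deg v, and the other entries form
  -- the inner degree.
  pencil-classSum : ∀ t v → sum (λ w → identity (κ w) (κ v) * pencil Γ t v w) ≡ (1ℚ - t) * D Γ v + innerDegree v
  pencil-classSum t v = begin
    sum (λ w → identity (κ w) (κ v) * pencil Γ t v w)
      ≡⟨ sum-cong-≗ (λ w → trans
           (cong (λ g → identity (κ w) (κ v) * (g - t * (identity v w * D Γ v))) (gram≡D+∣A∣ Γ v w))
           (solve 5 (λ δ i d a t → δ :* ((i :* d :+ a) :- t :* (i :* d)) :=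
                                   i :* (δ :* ((con 1ℚ :- t) :* d)) :+ δ :* a) refl
             (identity (κ w) (κ v)) (identity v w) (D Γ v) (∣A∣ Γ v w) t)) ⟩
    sum (λ w → identity v w * (identity (κ w) (κ v) * ((1ℚ - t) * D Γ v)) + identity (κ w) (κ v) * ∣A∣ Γ v w)
      ≡⟨ ∑-distrib-+ (λ w → identity v w * (identity (κ w) (κ v) * ((1ℚ - t) * D Γ v)))
           (λ w → identity (κ w) (κ v) * ∣A∣ Γ v w) ⟩
    sum (λ w → identity v w * (identity (κ w) (κ v) * ((1ℚ - t) * D Γ v))) + innerDegree v
      ≡⟨ cong (_+ innerDegree v) (trans
           (sum-identity v (λ w → identity (κ w) (κ v) * ((1ℚ - t) * D Γ v)))
           (trans (cong (_* ((1ℚ - t) * D Γ v)) (identity-refl (κ v))) (ℚ.*-identityˡ ((1ℚ - t) * D Γ v)))) ⟩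
    (1ℚ - t) * D Γ v + innerDegree v ∎
    where open ≡-Reasoning

  -- The average of inner degree over degree, weighted by degrees. It is a rational stand-in for the
  -- real q, which keeps the Hoffman inequality over ℚ.
  meanInnerDegree : ℚ
  meanInnerDegree = sum innerDegree * 1/₀ volume Γ

module _ (Γ : Hypergraph) {c : ℕ} (uniform : IsUniform c Γ) where

  pencil-rowSum : ∀ t v → sum (pencil Γ t v) ≡ (ι c - t) * D Γ v
  pencil-rowSum t v = begin
    sum (λ w → gram Γ v w - t * (identity v w * D Γ v))
      ≡⟨ sum-affine (gram Γ v) (λ w → identity v w * D Γ v) t ⟩
    sum (gram Γ v) - t * sum (λ w → identity v w * D Γ v)
      ≡⟨ cong₂ (λ p q → p - t * q) (codegs-rowSum (edges Γ) uniform v) (sum-identity v (λ _ → D Γ v)) ⟩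
    ι c * D Γ v - t * D Γ v
      ≡⟨ solve 3 (λ c t d → c :* d :- t :* d := (c :- t) :* d) refl (ι c) t (D Γ v) ⟩
    (ι c - t) * D Γ v ∎
    where open ≡-Reasoning

  module _ {k : ℕ} (κ : Coloring Γ k) where

    -- Each row enters as k² times its class sum minus k times its full sum.
    sum-quad-pencil-test : ∀ t → sum (λ i → quad (pencil Γ t) (λ v → test (κ v) i)) ≡
      ι k * (ι k * ((1ℚ - t) * volume Γ + sum (innerDegree Γ κ)) - (ι c - t) * volume Γ)
    sum-quad-pencil-test t = begin
      sum (λ i → quad (pencil Γ t) (λ v → test (κ v) i))
        ≡⟨ sum-quad-test (pencil Γ t) κ ⟩
      sum (λ v → sum (λ w → pencil Γ t v w * (ι k * (identity (κ w) (κ v) * ι k - 1ℚ))))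
        ≡⟨ sum-cong-≗ row ⟩
      sum (λ v → ι k * ι k * ((1ℚ - t) * D Γ v + innerDegree Γ κ v) - ι k * (ι c - t) * D Γ v)
        ≡⟨ sum-affine (λ v → ι k * ι k * ((1ℚ - t) * D Γ v + innerDegree Γ κ v)) (D Γ) (ι k * (ι c - t)) ⟩
      sum (λ v → ι k * ι k * ((1ℚ - t) * D Γ v + innerDegree Γ κ v)) - ι k * (ι c - t) * volume Γ
        ≡⟨ cong (_- ι k * (ι c - t) * volume Γ) (trans
             (sum-scale (ι k * ι k) (λ v → (1ℚ - t) * D Γ v + innerDegree Γ κ v))
             (cong (ι k * ι k *_) (trans (∑-distrib-+ (λ v → (1ℚ - t) * D Γ v) (innerDegree Γ κ))
               (cong (_+ sum (innerDegree Γ κ)) (sum-scale (1ℚ - t) (D Γ)))))) ⟩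
      ι k * ι k * ((1ℚ - t) * volume Γ + sum (innerDegree Γ κ)) - ι k * (ι c - t) * volume Γ
        ≡⟨ solve 4 (λ k x y z → k :* k :* x :- k :* y :* z := k :* (k :* x :- y :* z)) refl
             (ι k) ((1ℚ - t) * volume Γ + sum (innerDegree Γ κ)) (ι c - t) (volume Γ) ⟩
      ι k * (ι k * ((1ℚ - t) * volume Γ + sum (innerDegree Γ κ)) - (ι c - t) * volume Γ) ∎
      where
      open ≡-Reasoning
      row : ∀ v → sum (λ w → pencil Γ t v w * (ι k * (identity (κ w) (κ v) * ι k - 1ℚ))) ≡
                  ι k * ι k * ((1ℚ - t) * D Γ v + innerDegree Γ κ v) - ι k * (ι c - t) * D Γ v
      row v = begin
        sum (λ w → pencil Γ t v w * (ι k * (identity (κ w) (κ v) * ι k - 1ℚ)))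
          ≡⟨ sum-cong-≗ (λ w → solve 3 (λ s k δ → s :* (k :* (δ :* k :- con 1ℚ)) := k :* k :* (δ :* s) :- k :* s) refl
               (pencil Γ t v w) (ι k) (identity (κ w) (κ v))) ⟩
        sum (λ w → ι k * ι k * (identity (κ w) (κ v) * pencil Γ t v w) - ι k * pencil Γ t v w)
          ≡⟨ sum-affine (λ w → ι k * ι k * (identity (κ w) (κ v) * pencil Γ t v w)) (pencil Γ t v) (ι k) ⟩
        sum (λ w → ι k * ι k * (identity (κ w) (κ v) * pencil Γ t v w)) - ι k * sum (pencil Γ t v)
          ≡⟨ cong₂ (λ p q → p - ι k * q)
               (trans (sum-scale (ι k * ι k) (λ w → identity (κ w) (κ v) * pencil Γ t v w))
                 (cong (ι k * ι k *_) (pencil-classSum Γ κ t v)))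
               (pencil-rowSum t v) ⟩
        ι k * ι k * ((1ℚ - t) * D Γ v + innerDegree Γ κ v) - ι k * ((ι c - t) * D Γ v)
          ≡⟨ cong (λ p → ι k * ι k * ((1ℚ - t) * D Γ v + innerDegree Γ κ v) - p)
               (sym (ℚ.*-assoc (ι k) (ι c - t) (D Γ v))) ⟩
        ι k * ι k * ((1ℚ - t) * D Γ v + innerDegree Γ κ v) - ι k * (ι c - t) * D Γ v ∎

    -- The summed form is nonnegative, and its positive factors k and the volume cancel.
    PSD⇒hoffman : 0ℚ ℚ.< ι k → 0ℚ ℚ.< volume Γ → ∀ t → PSD (pencil Γ t) →
      t * (ι k - 1ℚ) ℚ.≤ ι k * (1ℚ + meanInnerDegree Γ κ) - ι c
    PSD⇒hoffman 0<k 0<vol t psd = ≤-by 0≤gap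
      (solve 4 (λ t k m c → k :* (con 1ℚ :+ m) :- c :=
          t :* (k :- con 1ℚ) :+ (k :* ((con 1ℚ :- t) :+ m) :- (c :- t))) refl
        t (ι k) (meanInnerDegree Γ κ) (ι c))
      where
      cancel : ∀ p {x} → 0ℚ ℚ.< p → 0ℚ ℚ.≤ p * x → 0ℚ ℚ.≤ x
      cancel p {x} 0<p 0≤px = ℚ.*-cancelˡ-≤-pos {0ℚ} {x} p {{ℚ.positive 0<p}}
        (subst (ℚ._≤ p * x) (sym (ℚ.*-zeroʳ p)) 0≤px)
      0≤gap : 0ℚ ℚ.≤ ι k * ((1ℚ - t) + meanInnerDegree Γ κ) - (ι c - t)
      0≤gap = cancel (volume Γ) 0<vol (cancel (ι k) 0<k (subst (0ℚ ℚ.≤_)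
        (trans (sum-quad-pencil-test t) (trans
          (cong (λ s → ι k * (ι k * ((1ℚ - t) * volume Γ + s) - (ι c - t) * volume Γ))
            (sym (p*1/₀q*q≡p (sum (innerDegree Γ κ)) (volume Γ) 0<vol)))
          (solve 5 (λ k u m y z → k :* (k :* (u :* z :+ m :* z) :- y :* z) := k :* (z :* (k :* (u :+ m) :- y))) refl
            (ι k) (1ℚ - t) (meanInnerDegree Γ κ) (ι c - t) (volume Γ))))
        (sum-nonneg λ i → psd (λ v → test (κ v) i))))

≡⇒≈ℝ : ∀ x y → (∀ n → seq x n ≡ seq y n) → x ≈ℝ y
≡⇒≈ℝ x y x≗y ε 0<ε = 0 , λ n _ → subst (ℚ._≤ ε)
  (cong ℚ.∣_∣ (sym (trans (cong (_- seq y n) (x≗y n)) (ℚ.+-inverseʳ (seq y n))))) (ℚ.<⇒≤ 0<ε)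

fromℚ-mono : ∀ {p q} → p ℚ.≤ q → fromℚ p ≤ℝ fromℚ q
fromℚ-mono {p} {q} p≤q = frequently-≤⇒≤ℝ (fromℚ p) (fromℚ q) λ N → N , ℕ.≤-refl , p≤q

-- Distinct naturals differ by at least 1, so a tolerance of ½ separates them.
fromℕ-cancel : ∀ {m n} → fromℕ m ≤ℝ fromℕ n → m ≤ n
fromℕ-cancel {m} {n} m≤n = ℕ.≮⇒≥ λ n<m →
  let N , h = m≤n ½ (ℚ.positive⁻¹ ½) in
  <⇒≱ (ℚ.positive⁻¹ ½) (≤-by (≤⇒0≤- (h N ℕ.≤-refl) ⊕ ≤⇒0≤- (subst (ℚ._≤ ι m) (ι-+ 1 n) (ι-mono n<m)))
    (solve 2 (λ m n → con 0ℚ := con ½ :+ (((n :+ con ½) :- m) :+ (m :- (con 1ℚ :+ n)))) refl (ι m) (ι n)))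

0<ι : ∀ {n} → Fin n → 0ℚ ℚ.< ι n
0<ι {suc n} _ = ℚ.<-≤-trans 0<1 (ι-mono {1} {suc n} (s≤s z≤n))

vertexOf : ∀ {n c} → 2 ≤ c → (es : List (Subset n)) → es ≢ [] → All (λ e → ∣ e ∣ ≡ c) es → Fin n
vertexOf {n}     _   []            es≢[] _          = contradiction refl es≢[]
vertexOf {suc n} _   (_ ∷ _)       _     _          = zero
vertexOf {zero}  ()  (Vec.[] ∷ _)  _     (refl ∷ _)

∣A∣-diagonal : ∀ Γ v → ∣A∣ Γ v v ≡ 0ℚ
∣A∣-diagonal Γ v = cong (λ b → ι ℤ.∣ if b then ℤ.+ 0 else ℤ.- (ℤ.+ codeg Γ v v) ∣) (dec-true (v Fin.≟ v) refl)

-- The lower bound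

module _ {c : ℕ} (2≤c : 2 ≤ c) (Γ : Hypergraph) (uniform : IsUniform c Γ) (E≢[] : edges Γ ≢ [])
         (deg≥1 : NoIsolatedVertices Γ) where

  v₀ : Vertex Γ
  v₀ = vertexOf 2≤c (edges Γ) E≢[] uniform

  0<volume : 0ℚ ℚ.< volume Γ
  -- Degrees are at least 1, so the volume is at least the number of vertices.
  0<volume = ℚ.<-≤-trans (0<ι v₀) (≤-by (sum-nonneg λ v → ≤⇒0≤- (1≤D Γ deg≥1 v))
    (sym (trans (cong (ι (order Γ) +_) (trans (sum-affine (D Γ) (λ _ → 1ℚ) 1ℚ)
        (cong (λ s → volume Γ - 1ℚ * s) (sum-ones (order Γ)))))
      (solve 2 (λ n v → n :+ (v :- con 1ℚ :* n) := v) refl (ι (order Γ)) (volume Γ)))))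

  -- Since deg v ≥ 1, the error ε is at most ε deg v and so survives the weighted averaging.
  meanInnerDegree≤ : ∀ {k} (κ : Coloring Γ k) x {ε} → 0ℚ ℚ.≤ ε →
    (∀ v → innerDegree Γ κ v ℚ.≤ x * D Γ v + ε) → meanInnerDegree Γ κ ℚ.≤ x + ε
  meanInnerDegree≤ κ x {ε} 0≤ε inner≤ = ℚ.*-cancelʳ-≤-pos {meanInnerDegree Γ κ} {x + ε}
    (volume Γ) {{ℚ.positive 0<volume}}
    (subst (ℚ._≤ (x + ε) * volume Γ) (sym (p*1/₀q*q≡p s (volume Γ) 0<volume))
      (≤-by (sum-nonneg gap) (sym (trans (cong (s +_) (trans
          (sum-affine (λ v → (x + ε) * D Γ v) (innerDegree Γ κ) 1ℚ)
          (cong (_- 1ℚ * s) (sum-scale (x + ε) (D Γ)))))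
        (solve 2 (λ s a → s :+ (a :- con 1ℚ :* s) := a) refl s ((x + ε) * volume Γ))))))
    where
    s = sum (innerDegree Γ κ)
    gap : ∀ v → 0ℚ ℚ.≤ (x + ε) * D Γ v - 1ℚ * innerDegree Γ κ v
    gap v = subst (0ℚ ℚ.≤_)
      (solve 4 (λ x ε d i → ((x :* d :+ ε) :- i) :+ ε :* (d :- con 1ℚ) := (x :+ ε) :* d :- con 1ℚ :* i) refl
        x ε (D Γ v) (innerDegree Γ κ v))
      (≤⇒0≤- (inner≤ v) ⊕ 0≤ε ⊗ ≤⇒0≤- (1≤D Γ deg≥1 v))

  -- Tailoredness is a finite family of eventual inequalities; from some index on they hold together
  -- and can be averaged.
  tailored⇒meanInnerDegree≤q : ∀ {q k} (κ : Coloring Γ k) → IsTailored Γ q κ →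
                               fromℚ (meanInnerDegree Γ κ) ≤ℝ q
  tailored⇒meanInnerDegree≤q {q} κ tailored ε 0<ε =
    let N , h = eventually-∀ (λ v → tailored (κ v) v refl ε 0<ε) in
    N , λ n N≤n → meanInnerDegree≤ κ (seq q n) (ℚ.<⇒≤ 0<ε) λ v →
      subst (ℚ._≤ seq q n * D Γ v + ε) (ι-innerDegree Γ κ (κ v) v refl) (h n N≤n v)

  module _ {λ₁ : ℝ} (smallest : IsSmallestEigenvalue (laplacian Γ deg≥1) λ₁) where

    hoffman : ∀ {k} (κ : Coloring Γ k) →
      λ₁ *ℝ fromℚ (ι k - 1ℚ) ≤ℝ fromℚ (ι k * (1ℚ + meanInnerDegree Γ κ) - ι c)
    hoffman {k} κ = rayleigh Γ deg≥1 v₀ {λ₁} smallest (ι k - 1ℚ) _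
      (≤⇒0≤- (1≤ι (κ v₀))) (PSD⇒hoffman Γ uniform κ (0<ι (κ v₀)) 0<volume)
      where
      1≤ι : ∀ {n} → Fin n → 1ℚ ℚ.≤ ι n
      1≤ι {suc n} _ = ι-mono {1} {suc n} (s≤s z≤n)

    rainbow-meanInnerDegree : meanInnerDegree Γ id ≡ 0ℚ
    rainbow-meanInnerDegree = trans (cong (_* 1/₀ volume Γ) (sum-zero inner≡0)) (ℚ.*-zeroˡ (1/₀ volume Γ))
      where
      inner≡0 : ∀ v → innerDegree Γ id v ≡ 0ℚ
      inner≡0 v = trans (sum-cong-≗ λ w → cong (_* ∣A∣ Γ v w) (identity-sym w v))
        (trans (sum-identity v (∣A∣ Γ v)) (∣A∣-diagonal Γ v))

    -- The colouring with one vertex per class gives (N - 1)(1 - λ₁) ≥ c - 1 > 0.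
    λ₁<1 : λ₁ <ℝ 1ℝ
    λ₁<1 = δ , 0<δ , proj₁ ev , λ n h → ℚ.≮⇒≥ λ 1<λ+δ → <⇒≱ 0<δ (contra (seq λ₁ n) 1<λ+δ
      (subst (λ m → seq λ₁ n * (N - 1ℚ) ℚ.≤ (N * (1ℚ + m) - ι c) + ½) rainbow-meanInnerDegree (proj₂ ev n h)))
      where
      N = ι (order Γ)
      -- With tolerance ½ the inequality gives (N - 1)(1 - l) ≥ c - 3/2 ≥ ½ for an approximation l
      -- of λ₁, whereas 1 - l < δ would give at most ½ - δ.
      δ = ½ * 1/₀ N
      0<δ : 0ℚ ℚ.< δ
      0<δ = 0<½*ε {1/₀ N} (0<p⇒0<1/₀p {N} (0<ι v₀))
      ev = hoffman id ½ (ℚ.positive⁻¹ ½)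
      1≤N : 1ℚ ℚ.≤ N
      1≤N = ι-mono {1} (ℕ.≤-trans (s≤s z≤n) (Fin.toℕ<n v₀))
      contra : ∀ l → 1ℚ ℚ.< l + δ → l * (N - 1ℚ) ℚ.≤ (N * (1ℚ + 0ℚ) - ι c) + ½ → δ ℚ.≤ 0ℚ
      contra l 1<l+δ l≤ = ≤-by
        (≤⇒0≤- 1≤N ⊗ ≤⇒0≤- (ℚ.<⇒≤ 1<l+δ) ⊕ ≤⇒0≤- l≤ ⊕ ≤⇒0≤- (ι-mono 2≤c))
        (trans (sym (ℚ.+-inverseʳ (δ * N)))
          (trans (cong (λ p → δ * N - p) (p*1/₀q*q≡p ½ N (0<ι v₀)))
            (solve 4 (λ l d n c → d :* n :- con ½ := d :+
              (((n :- con 1ℚ) :* ((l :+ d) :- con 1ℚ) :+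
                (((n :* (con 1ℚ :+ con 0ℚ) :- c) :+ con ½) :- l :* (n :- con 1ℚ))) :+ (c :- con (ι 2)))) refl
              l δ N (ι c))))

    -- Of the gap δ between λ₁ and 1, one half absorbs the error in 0 ≤ q and the other half
    -- remains.
    denominator-positive : ∀ {q} → 0ℝ ≤ℝ q → 0ℝ <ℝ q +ℝ 1ℝ -ℝ λ₁
    denominator-positive {q} 0≤q =
      let δ , 0<δ , λ+δ≤1 = λ₁<1 in
      ½ * δ , 0<½*ε 0<δ , eventually-∧
        (λ n λ+δ≤1 0≤q+½δ → ≤-by (≤⇒0≤- λ+δ≤1 ⊕ ≤⇒0≤- 0≤q+½δ)
          (solve 3 (λ l q δ → (q :+ con 1ℚ) :- l :=
              (con 0ℚ :+ con ½ :* δ) :+ ((con 1ℚ :- (l :+ δ)) :+ ((q :+ con ½ :* δ) :- con 0ℚ))) refl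
            (seq λ₁ n) (seq q n) δ))
        λ+δ≤1 (0≤q (½ * δ) (0<½*ε 0<δ))

    -- With the mean inner degree at most q, `hoffman` rearranges to c - λ₁ ≤ k (q + 1 - λ₁).
    tailored-bound : ∀ {q k} → HasTailoredColoring Γ q k → (pos : 0ℝ <ℝ q +ℝ 1ℝ -ℝ λ₁) →
                     (fromℕ c -ℝ λ₁) ÷ℝ (q +ℝ 1ℝ -ℝ λ₁) ⟨ pos ⟩ ≤ℝ fromℕ k
    tailored-bound {q} {k} (κ , tailored) (δ , 0<δ , δ≤Y) ε 0<ε = eventually-∧
      (λ n δ≤y (h₁ , h₂) → ratio (seq λ₁ n) (seq q n)
        (subst (ℚ._≤ seq q n + 1ℚ - seq λ₁ n) (ℚ.+-identityˡ δ) δ≤y) h₁ h₂)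
      δ≤Y (eventually-∧ (λ n → _,_) (hoffman κ η 0<η) (tailored⇒meanInnerDegree≤q {q} κ tailored ζ 0<ζ))
      where
      m = meanInnerDegree Γ κ
      0<k = 0<ι (κ v₀)
      -- The errors η and k ζ add up to ε δ, which is at most ε y because the denominator y is at
      -- least δ.
      η = ½ * (ε * δ)
      0<η : 0ℚ ℚ.< η
      0<η = 0<½*ε {ε * δ} (0<p*q {ε} {δ} 0<ε 0<δ)
      ζ = η * 1/₀ ι k
      0<ζ : 0ℚ ℚ.< ζ
      0<ζ = 0<p*q {η} {1/₀ ι k} 0<η (0<p⇒0<1/₀p {ι k} 0<k)
      ratio : ∀ l x → δ ℚ.≤ x + 1ℚ - l → l * (ι k - 1ℚ) ℚ.≤ ι k * (1ℚ + m) - ι c + η → m ℚ.≤ x + ζ →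
              (ι c - l) * 1/₀ (x + 1ℚ - l) ℚ.≤ ι k + ε
      ratio l x δ≤y h₁ h₂ = ℚ.*-cancelʳ-≤-pos {(ι c - l) * 1/₀ y} {ι k + ε} y {{ℚ.positive 0<y}}
        (subst (ℚ._≤ (ι k + ε) * y) (sym (p*1/₀q*q≡p (ι c - l) y 0<y))
          (≤-by (≤⇒0≤- h₁ ⊕ ℚ.<⇒≤ 0<k ⊗ ≤⇒0≤- h₂ ⊕ ℚ.<⇒≤ 0<ε ⊗ ≤⇒0≤- δ≤y)
            (trans (solve 7 (λ c k l x m ε δ → (k :+ ε) :* ((x :+ con 1ℚ) :- l) :=
                let η = con ½ :* (ε :* δ) in
                (c :- l) :+ ((((k :* (con 1ℚ :+ m) :- c) :+ η) :- l :* (k :- con 1ℚ)) :+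
                  (k :* (x :- m) :+ η) :+ ε :* (((x :+ con 1ℚ) :- l) :- δ))) refl
                (ι c) (ι k) l x m ε δ)
              (cong (λ p → (ι c - l) + ((((ι k * (1ℚ + m) - ι c) + η) - l * (ι k - 1ℚ)) + p + ε * (y - δ)))
                (trans (cong (ι k * (x - m) +_) (sym (p*1/₀q*q≡p η (ι k) 0<k)))
                  (solve 4 (λ k x m z → k :* (x :- m) :+ z :* k := k :* ((x :+ z) :- m)) refl (ι k) x m ζ))))))
        where
        y = x + 1ℚ - l
        0<y : 0ℚ ℚ.< y
        0<y = ℚ.<-≤-trans 0<δ δ≤y

-- The hypergraph with a single edge

sum-split : ∀ a {b} (f : Fin (a ℕ.+ b) → ℚ) → sum f ≡ sum (λ i → f (i ↑ˡ b)) + sum (λ j → f (a ↑ʳ j))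
sum-split zero    f = sym (ℚ.+-identityˡ (sum f))
sum-split (suc a) {b} f = trans (cong (f zero +_) (sum-split a (λ i → f (suc i))))
  (sym (ℚ.+-assoc (f zero) (sum λ i → f (suc i ↑ˡ b)) (sum λ j → f (suc a ↑ʳ j))))

quotient-↑ˡ : ∀ {m} s (j : Fin s) → quotient {suc m} s (j ↑ˡ (m ℕ.* s)) ≡ zero
quotient-↑ˡ {m} s j rewrite Fin.splitAt-↑ˡ s j (m ℕ.* s) = refl

quotient-↑ʳ : ∀ {m} s (j : Fin (m ℕ.* s)) → quotient {suc m} s (s ↑ʳ j) ≡ suc (quotient {m} s j)
quotient-↑ʳ {m} s j rewrite Fin.splitAt-↑ʳ s (m ℕ.* s) j = refl

-- `quotient` colours consecutive blocks of s vertices; the induction peels off the first block.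
sum-quotient : ∀ m s (i : Fin m) → sum (λ w → identity (quotient {m} s w) i) ≡ ι s
sum-quotient (suc m) s i = trans (sum-split s (λ w → identity (quotient {suc m} s w) i)) (trans
  (cong₂ _+_ (sum-cong-≗ λ j → cong (λ a → identity a i) (quotient-↑ˡ {m} s j))
             (sum-cong-≗ λ j → cong (λ a → identity a i) (quotient-↑ʳ {m} s j)))
  (blocks i))
  where
  blocks : ∀ i → sum {s} (λ _ → identity {suc m} zero i) +
                 sum (λ j → identity (suc (quotient {m} s j)) i) ≡ ι s
  blocks zero    = trans (cong₂ _+_ (sum-ones s) (sum-zero {m ℕ.* s} λ _ → refl)) (ℚ.+-identityʳ (ι s))
  blocks (suc i) = trans (cong₂ _+_ (sum-zero {s} λ _ → refl)
    (trans (sum-cong-≗ λ j → identity-suc (quotient {m} s j) i) (sum-quotient m s i))) (ℚ.+-identityˡ (ι s))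

-- Such a vector is an eigenvector of the all-ones matrix for the eigenvalue 0.
balanced : ∀ c → 2 ≤ c → ∃ λ (h : Fin c → ℚ) → sum h ≡ 0ℚ × ∃ λ v → h v ≡ 1ℚ
balanced (suc zero)    (s≤s ())
balanced (suc (suc c)) _ = (1ℚ ∷ᶠ (- 1ℚ) ∷ᶠ λ _ → 0ℚ) ,
  cong (λ s → 1ℚ + (- 1ℚ + s)) (sum-zero {c} λ _ → refl) , zero , refl

∣sum∣≤ : ∀ {n} (f : Fin n → ℚ) {ε} → (∀ i → ℚ.∣ f i ∣ ℚ.≤ ε) → ℚ.∣ sum f ∣ ℚ.≤ ι n * ε
∣sum∣≤ {zero}  f {ε} f≤ε = ℚ.≤-reflexive (sym (ℚ.*-zeroˡ ε))
∣sum∣≤ {suc n} f {ε} f≤ε = begin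
  ℚ.∣ f zero + sum (λ i → f (suc i)) ∣         ≤⟨ ℚ.∣p+q∣≤∣p∣+∣q∣ (f zero) (sum λ i → f (suc i)) ⟩
  ℚ.∣ f zero ∣ + ℚ.∣ sum (λ i → f (suc i)) ∣   ≤⟨ ℚ.+-mono-≤ (f≤ε zero) (∣sum∣≤ (λ i → f (suc i)) (λ i → f≤ε (suc i))) ⟩
  ε + ι n * ε                                  ≡⟨ solve 2 (λ n ε → ε :+ n :* ε := (con 1ℚ :+ n) :* ε) refl (ι n) ε ⟩
  (1ℚ + ι n) * ε                               ≡⟨ cong (_* ε) (ι-+ 1 n) ⟨
  ι (suc n) * ε                                ∎
  where open ℚ.≤-Reasoning

-- If x ≤ - δ and all f v x are within ε of s = Σ f, then (c - x) s is within
-- c ε of 0, so ∣s∣ ≤ ε, and hence ∣f v∣ ≤ 2 ε / δ.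
negative-eigenvalue-estimate : ∀ {c} (f : Fin c → ℚ) → Fin c → ∀ x {δ ε} → x + δ ℚ.≤ 0ℚ → 0ℚ ℚ.≤ δ →
  (∀ v → ℚ.∣ sum f - x * f v ∣ ℚ.≤ ε) → ∀ v → δ * ℚ.∣ f v ∣ ℚ.≤ ε + ε
negative-eigenvalue-estimate {c} f v₀ x {δ} {ε} x+δ≤0 0≤δ close v = begin
  δ * ℚ.∣ f v ∣
    ≤⟨ ≤-by (≤⇒0≤- x+δ≤0 ⊗ ℚ.0≤∣p∣ (f v))
         (solve 3 (λ x δ a → :- x :* a := δ :* a :+ (con 0ℚ :- (x :+ δ)) :* a) refl x δ ℚ.∣ f v ∣) ⟩
  - x * ℚ.∣ f v ∣
    ≡⟨ cong (_* ℚ.∣ f v ∣) (ℚ.0≤p⇒∣p∣≡p 0≤-x) ⟨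
  ℚ.∣ - x ∣ * ℚ.∣ f v ∣
    ≡⟨ ℚ.∣p*q∣≡∣p∣*∣q∣ (- x) (f v) ⟨
  ℚ.∣ - x * f v ∣
    ≡⟨ cong ℚ.∣_∣ (solve 3 (λ s x a → :- x :* a := (s :- x :* a) :- s) refl s x (f v)) ⟩
  ℚ.∣ (s - x * f v) - s ∣
    ≤⟨ ℚ.∣p-q∣≤∣p∣+∣q∣ (s - x * f v) s ⟩
  ℚ.∣ s - x * f v ∣ + ℚ.∣ s ∣
    ≤⟨ ℚ.+-mono-≤ (close v) ∣s∣≤ε ⟩
  ε + ε ∎
  where
  open ℚ.≤-Reasoning
  s = sum f
  0≤-x : 0ℚ ℚ.≤ - x
  0≤-x = ≤-by (≤⇒0≤- x+δ≤0 ⊕ 0≤δ) (solve 2 (λ x δ → :- x := con 0ℚ :+ ((con 0ℚ :- (x :+ δ)) :+ δ)) refl x δ)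
  sum-gaps : sum (λ v → s - x * f v) ≡ (ι c - x) * s
  sum-gaps = trans (sum-affine (λ _ → s) f x) (trans
    (cong (_- x * s) (trans (sum-cong-≗ {c} λ _ → sym (ℚ.*-identityʳ s))
      (trans (sum-scale {c} s (λ _ → 1ℚ)) (cong (s *_) (sum-ones c)))))
    (solve 3 (λ s c x → s :* c :- x :* s := (c :- x) :* s) refl s (ι c) x))
  ∣s∣≤ε : ℚ.∣ s ∣ ℚ.≤ ε
  ∣s∣≤ε = ℚ.*-cancelˡ-≤-pos {ℚ.∣ s ∣} {ε} (ι c) {{ℚ.positive (0<ι v₀)}} (begin
    ι c * ℚ.∣ s ∣
      ≤⟨ ≤-by (0≤-x ⊗ ℚ.0≤∣p∣ s) (solve 3 (λ c x a → (c :- x) :* a := c :* a :+ :- x :* a) refl (ι c) x ℚ.∣ s ∣) ⟩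
    (ι c - x) * ℚ.∣ s ∣
      ≡⟨ cong (_* ℚ.∣ s ∣) (ℚ.0≤p⇒∣p∣≡p (0≤ι c ⊕ 0≤-x)) ⟨
    ℚ.∣ ι c - x ∣ * ℚ.∣ s ∣
      ≡⟨ ℚ.∣p*q∣≡∣p∣*∣q∣ (ι c - x) s ⟨
    ℚ.∣ (ι c - x) * s ∣
      ≡⟨ cong ℚ.∣_∣ sum-gaps ⟨
    ℚ.∣ sum (λ v → s - x * f v) ∣
      ≤⟨ ∣sum∣≤ (λ v → s - x * f v) close ⟩
    ι c * ε ∎)

-- It suffices to refute ν < 0, and a gap ν + δ ≤ 0 forces the eigenvector to vanish.
allOnes-eigenvalue-nonneg : ∀ {c} (M : Matrix ℚ c) → (∀ v w → M v w ≡ 1ℚ) → ∀ ν → IsEigenvalue M ν → 0ℝ ≤ℝ ν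
allOnes-eigenvalue-nonneg {zero}  M M≡1 ν (f , f≉0 , _) = contradiction (λ ()) f≉0
allOnes-eigenvalue-nonneg {suc c} M M≡1 ν (f , f≉0 , Mf≈νf) = ≮ℝ⇒≥ℝ 0ℝ ν λ (δ , 0<δ , ν+δ≤0) →
  f≉0 λ v ε 0<ε → f-small δ 0<δ ν+δ≤0 v ε 0<ε
  where
  fₖ : ℕ → Fin (suc c) → ℚ
  fₖ k v = seq (f v) k
  row : ∀ k v → seq ((M · f) v) k ≡ sum (fₖ k)
  row k v = trans (seq-Σℝ (λ w → fromℚ (M v w) *ℝ f w) k)
    (sum-cong-≗ λ w → trans (cong (_* fₖ k w) (M≡1 v w)) (ℚ.*-identityˡ (fₖ k w)))
  f-small : ∀ δ → 0ℚ ℚ.< δ → Eventually (λ k → seq ν k + δ ℚ.≤ 0ℚ) → ∀ v → f v ≈ℝ 0ℝ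
  f-small δ 0<δ ν+δ≤0 v ε 0<ε = eventually-∧ bound ν+δ≤0
    -- This tolerance cancels the factor 2 / δ of the estimate.
    (eventually-∀ λ w → Mf≈νf w (½ * (δ * ε)) (0<½*ε {δ * ε} (0<p*q {δ} {ε} 0<δ 0<ε)))
    where
    bound : ∀ k → seq ν k + δ ℚ.≤ 0ℚ →
      (∀ w → ℚ.∣ seq ((M · f) w) k - seq ν k * fₖ k w ∣ ℚ.≤ ½ * (δ * ε)) → ℚ.∣ fₖ k v - 0ℚ ∣ ℚ.≤ ε
    bound k νk+δ≤0 close = subst (ℚ._≤ ε) (cong ℚ.∣_∣ (sym (ℚ.+-identityʳ (fₖ k v))))
      (ℚ.*-cancelˡ-≤-pos {ℚ.∣ fₖ k v ∣} {ε} δ {{ℚ.positive 0<δ}}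
        (subst (δ * ℚ.∣ fₖ k v ∣ ℚ.≤_) (solve 1 (λ p → con ½ :* p :+ con ½ :* p := p) refl (δ * ε))
          (negative-eigenvalue-estimate (fₖ k) zero (seq ν k) {δ} {½ * (δ * ε)} νk+δ≤0 (ℚ.<⇒≤ 0<δ)
            (λ w → subst (λ r → ℚ.∣ r - seq ν k * fₖ k w ∣ ℚ.≤ ½ * (δ * ε)) (row k w) (close w)) v)))

allOnes-smallestEigenvalue : ∀ {c} → 2 ≤ c → (M : Matrix ℚ c) → (∀ v w → M v w ≡ 1ℚ) → IsSmallestEigenvalue M 0ℝ
allOnes-smallestEigenvalue {c} 2≤c M M≡1 =
  let h , sum-h≡0 , v , hv≡1 = balanced c 2≤c in
  ( (λ w → fromℚ (h w)) , (λ h≈0 → 1≉0 (subst (λ p → fromℚ p ≈ℝ 0ℝ) hv≡1 (h≈0 v)))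
  , λ w → ≡⇒≈ℝ ((M · (λ u → fromℚ (h u))) w) (0ℝ *ℝ fromℚ (h w)) λ k →
      trans (seq-Σℝ (λ u → fromℚ (M w u) *ℝ fromℚ (h u)) k)
        (trans (sum-cong-≗ λ u → trans (cong (_* h u) (M≡1 w u)) (ℚ.*-identityˡ (h u)))
          (trans sum-h≡0 (sym (ℚ.*-zeroˡ (h w))))) )
  , allOnes-eigenvalue-nonneg M M≡1

module SingleEdge (c : ℕ) where

  Γ₁ : Hypergraph
  Γ₁ = record { order = c ; edges = ⊤ ∷ [] ; edgesUnique = [] AllPairs.∷ AllPairs.[] }

  uniform₁ : IsUniform c Γ₁
  uniform₁ = ∣⊤∣≡n c ∷ []

  edges₁≢[] : edges Γ₁ ≢ []
  edges₁≢[] ()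

  deg₁ : ∀ v → deg Γ₁ v ≡ 1
  deg₁ v = cong length (filter-accept (v ∈?_) {⊤} {[]} ∈⊤)

  codeg₁ : ∀ v w → codeg Γ₁ v w ≡ 1
  codeg₁ v w = cong length (filter-accept (λ e → (v ∈? e) ×-dec (w ∈? e)) {⊤} {[]} (∈⊤ , ∈⊤))

  deg₁≥1 : NoIsolatedVertices Γ₁
  deg₁≥1 v = ℕ.≤-reflexive (sym (deg₁ v))

  laplacian₁ : ∀ v w → laplacian Γ₁ deg₁≥1 v w ≡ 1ℚ
  laplacian₁ v w = begin
    laplacian Γ₁ deg₁≥1 v w            ≡⟨ ℚ.*-identityˡ _ ⟨
    ι 1 * laplacian Γ₁ deg₁≥1 v w      ≡⟨ cong (λ d → ι d * laplacian Γ₁ deg₁≥1 v w) (deg₁ v) ⟨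
    D Γ₁ v * laplacian Γ₁ deg₁≥1 v w   ≡⟨ D*laplacian≡gram Γ₁ deg₁≥1 v w ⟩
    gram Γ₁ v w                        ≡⟨ cong ι (codeg₁ v w) ⟩
    1ℚ                                 ∎
    where open ≡-Reasoning

  smallest₁ : 2 ≤ c → IsSmallestEigenvalue (laplacian Γ₁ deg₁≥1) 0ℝ
  smallest₁ 2≤c = allOnes-smallestEigenvalue 2≤c (laplacian Γ₁ deg₁≥1) laplacian₁

-- The block colouring that attains equality.

module _ (m q : ℕ) where

  open SingleEdge (m ℕ.* suc q)

  -- At t = 0 all entries of the pencil are 1, so the class sum counts the q + 1 vertices of a
  -- block, one of which is v itself.
  innerDegree₁ : ∀ v → innerDegree Γ₁ (quotient {m} (suc q)) v ≡ ι q
  innerDegree₁ v = begin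
    inner
      ≡⟨ solve 1 (λ i → i := ((con 1ℚ :- con 0ℚ) :* con (ι 1) :+ i) :- con 1ℚ) refl inner ⟩
    ((1ℚ - 0ℚ) * ι 1 + inner) - 1ℚ
      ≡⟨ cong (λ d → ((1ℚ - 0ℚ) * ι d + inner) - 1ℚ) (deg₁ v) ⟨
    ((1ℚ - 0ℚ) * D Γ₁ v + inner) - 1ℚ
      ≡⟨ cong (_- 1ℚ) (pencil-classSum Γ₁ κ 0ℚ v) ⟨
    sum (λ w → identity (κ w) (κ v) * pencil Γ₁ 0ℚ v w) - 1ℚ
      ≡⟨ cong (_- 1ℚ) (sum-cong-≗ λ w → trans
           (cong (λ g → identity (κ w) (κ v) * (ι g - 0ℚ * (identity v w * D Γ₁ v))) (codeg₁ v w))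
           (solve 2 (λ i d → i :* (con 1ℚ :- con 0ℚ :* d) := i) refl (identity (κ w) (κ v)) (identity v w * D Γ₁ v))) ⟩
    sum (λ w → identity (κ w) (κ v)) - 1ℚ
      ≡⟨ cong (_- 1ℚ) (trans (sum-quotient m (suc q) (κ v)) (ι-+ 1 q)) ⟩
    (1ℚ + ι q) - 1ℚ
      ≡⟨ solve 1 (λ q → (con 1ℚ :+ q) :- con 1ℚ := q) refl (ι q) ⟩
    ι q ∎
    where
    open ≡-Reasoning
    κ : Coloring Γ₁ m
    κ = quotient {m} (suc q)
    inner = innerDegree Γ₁ κ v

  tailored₁ : HasTailoredColoring Γ₁ (fromℕ q) m
  tailored₁ = κ , λ i v κv≡i → fromℚ-mono (ℚ.≤-reflexive (trans (ι-innerDegree Γ₁ κ i v κv≡i)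
    (trans (innerDegree₁ v) (sym (trans (cong (λ d → ι q * ι d) (deg₁ v)) (ℚ.*-identityʳ (ι q)))))))
    where
    κ : Coloring Γ₁ m
    κ = quotient {m} (suc q)

  ratio₁ : (pos : 0ℝ <ℝ fromℕ q +ℝ 1ℝ -ℝ 0ℝ) →
    fromℕ m ≈ℝ (fromℕ (m ℕ.* suc q) -ℝ 0ℝ) ÷ℝ (fromℕ q +ℝ 1ℝ -ℝ 0ℝ) ⟨ pos ⟩
  ratio₁ pos = ≡⇒≈ℝ (fromℕ m) ((fromℕ (m ℕ.* suc q) -ℝ 0ℝ) ÷ℝ (fromℕ q +ℝ 1ℝ -ℝ 0ℝ) ⟨ pos ⟩) λ _ → begin
    ι m                                ≡⟨ p*1/₀q*q≡p (ι m) y 0<y ⟨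
    ι m * 1/₀ y * y                    ≡⟨ solve 3 (λ m i y → m :* i :* y := m :* y :* i) refl (ι m) (1/₀ y) y ⟩
    ι m * y * 1/₀ y                    ≡⟨ cong (_* 1/₀ y) m*y≡ ⟩
    (ι (m ℕ.* suc q) - 0ℚ) * 1/₀ y     ∎
    where
    open ≡-Reasoning
    y = ι q + 1ℚ - 0ℚ
    y≡ : y ≡ ι (suc q)
    y≡ = trans (solve 1 (λ q → (q :+ con 1ℚ) :- con 0ℚ := con 1ℚ :+ q) refl (ι q)) (sym (ι-+ 1 q))
    0<y : 0ℚ ℚ.< y
    0<y = subst (0ℚ ℚ.<_) (sym y≡) (0<ι {suc q} zero)
    m*y≡ : ι m * y ≡ ι (m ℕ.* suc q) - 0ℚ
    m*y≡ = trans (cong (ι m *_) y≡) (trans (sym (ι-* m (suc q))) (sym (ℚ.+-identityʳ (ι (m ℕ.* suc q)))))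

  -- Minimality comes from the lower bound itself: a tailored colouring with k classes satisfies m =
  -- c / (q + 1) ≤ k.
  chromatic₁ : 2 ≤ m ℕ.* suc q → IsTailoredChromaticNumber Γ₁ (fromℕ q) m
  chromatic₁ 2≤c = tailored₁ , λ k has → fromℕ-cancel (≤ℝ-trans {fromℕ m} {ratio} {fromℕ k}
    (≈ℝ⇒≤ℝ (fromℕ m) ratio (ratio₁ pos))
    (tailored-bound 2≤c Γ₁ uniform₁ edges₁≢[] deg₁≥1 {0ℝ} (smallest₁ 2≤c) {fromℕ q} has pos))
    where
    pos : 0ℝ <ℝ fromℕ q +ℝ 1ℝ -ℝ 0ℝ
    pos = denominator-positive 2≤c Γ₁ uniform₁ edges₁≢[] deg₁≥1 {0ℝ} (smallest₁ 2≤c) {fromℕ q} (fromℚ-mono (0≤ι q))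
    ratio : ℝ
    ratio = (fromℕ (m ℕ.* suc q) -ℝ 0ℝ) ÷ℝ (fromℕ q +ℝ 1ℝ -ℝ 0ℝ) ⟨ pos ⟩
    ≈ℝ⇒≤ℝ : ∀ x y → x ≈ℝ y → x ≤ℝ y
    ≈ℝ⇒≤ℝ x y x≈y ε 0<ε = let N , h = x≈y ε 0<ε in N , λ n N≤n → ∣p-q∣≤ε⇒p≤q+ε (seq x n) (seq y n) (h n N≤n)

mainTheorem11 : ∀ (c : ℕ) → 2 ≤ c →
    ( ∀ (Γ : Hypergraph) → IsUniform c Γ → edges Γ ≢ [] →
    ∀ (deg≥1 : NoIsolatedVertices Γ) →
    ∀ (λ₁ : ℝ) → IsSmallestEigenvalue (laplacian Γ deg≥1) λ₁ →
    ∀ (q : ℝ) → 0ℝ ≤ℝ q → q ≤ℝ fromℕ c -ℝ 1ℝ →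
    ∀ (χ : ℕ) → IsTailoredChromaticNumber Γ q χ →
    Σ[ pos ∈ 0ℝ <ℝ q +ℝ 1ℝ -ℝ λ₁ ]
    (fromℕ c -ℝ λ₁) ÷ℝ (q +ℝ 1ℝ -ℝ λ₁) ⟨ pos ⟩ ≤ℝ fromℕ χ )
    ×
    ( ∀ (q : ℕ) → suc q ∣ c →
    Σ[ Γ ∈ Hypergraph ] IsUniform c Γ × edges Γ ≢ [] ×
    (Σ[ deg≥1 ∈ NoIsolatedVertices Γ ]
    Σ[ λ₁ ∈ ℝ ] IsSmallestEigenvalue (laplacian Γ deg≥1) λ₁ ×
    (∃[ χ ] IsTailoredChromaticNumber Γ (fromℕ q) χ ×
    (Σ[ pos ∈ 0ℝ <ℝ fromℕ q +ℝ 1ℝ -ℝ λ₁ ]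
    fromℕ χ ≈ℝ (fromℕ c -ℝ λ₁) ÷ℝ (fromℕ q +ℝ 1ℝ -ℝ λ₁) ⟨ pos ⟩))) )
mainTheorem11 c 2≤c =
  ( λ Γ uniform E≢[] deg≥1 λ₁ smallest q 0≤q _ χ (has , _) →
      let pos = denominator-positive 2≤c Γ uniform E≢[] deg≥1 {λ₁} smallest {q} 0≤q in
      pos , tailored-bound 2≤c Γ uniform E≢[] deg≥1 {λ₁} smallest {q} has pos )
  , λ where
      q (divides m refl) →
        let open SingleEdge (m ℕ.* suc q)
            pos = denominator-positive 2≤c Γ₁ uniform₁ edges₁≢[] deg₁≥1 {0ℝ} (smallest₁ 2≤c) {fromℕ q}
                    (fromℚ-mono (0≤ι q))
        in Γ₁ , uniform₁ , edges₁≢[] , deg₁≥1 , 0ℝ , smallest₁ 2≤c , m , chromatic₁ m q 2≤c ,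
           pos , ratio₁ m q pos
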